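{- Let $n$ be a positive integer, $q=2^n$, $a_1\in\mathbb{F}_q^{*}$ and $b\in\mathbb{F}_{q^2}^{*}$. Then the Boolean function $h_1:\mathbb{F}_{q^2}\to\mathbb{F}_2$, $h_1(x)={\rm Tr}_1^{2n}\!\left(\frac{a_1}{x^{q-1}+b}\right)$, is bent if and only if one of the following conditions holds: (1) $b\in U\setminus\{1\}$ and ${\rm Tr}_1^{2n}\!\left(\frac{a_1}{b}\right)=0$; (2) $b\in\mathbb{F}_{q^2}^{*}\setminus U$, $\mathcal{K}_n\!\left(\frac{a_1}{1+b\overline{b}}\right)=0$ and ${\rm Tr}_1^{n}\!\left(\frac{a_1(b+\overline{b})}{(1+b\overline{b})\,b\overline{b}}\right)=0$.
   Context: For $k\mid m$, ${\rm Tr}_k^m(x)=x+x^{2^k}+\dots+x^{2^{(m/k-1)k}}$ is the trace from $\mathbb{F}_{2^m}$ to $\mathbb{F}_{2^k}$. For $x\in\mathbb{F}_{q^2}$, $\overline{x}=x^{q}$. $U=\{\eta\in\mathbb{F}_{q^2}:\eta^{q+1}=1\}$ is the unit circle. Convention: $\frac{1}{0}=0$ (i.e. $y^{ -1}$ means $y^{q^2-2}$). The binary Kloosterman sum is $\mathcal{K}_n(a)=\sum_{x\in\mathbb{F}_{2^n}}(-1)^{{\rm Tr}_1^n(1/x+ax)}$ for $a\in\mathbb{F}_{2^n}^*$. The Walsh transform of $f:\mathbb{F}_{2^{2n}}\to\mathbb{F}_2$ is $W_f(\omega)=\sum_{x\in\mathbb{F}_{2^{2n}}}(-1)^{f(x)+{\rm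 Tr}_1^{2n}(\omega x)}$, and $f$ is bent if $W_f(\omega)^2=2^{2n}$ for all $\omega$. -}

module Defs where

open import Level using (0ℓ)
open import Data.Nat as ℕ using (ℕ; zero; suc)
open import Data.Integer as ℤ using (ℤ)
open import Data.Bool using (Bool; true; false; _xor_)
open import Data.List using (List; []; _∷_; length; filter)
open import Data.List.Membership.Propositional using (_∈_)
open import Data.List.Relation.Unary.Unique.Propositional using (Unique)
open import Data.Product using (Σ; _×_; _,_)
open import Relation.Nullary using (¬_; Dec; yes; no; does)
open import Relation.Binary.PropositionalEquality using (_≡_; _≢_)
open import Algebra.Structures using (IsCommutativeRing)

-- A finite field with exactly 2^m elements (m given as index), with
-- propositional equality, decidable equality and an explicit duplicate-free
-- complete enumeration of its elements.  Characteristic 2 follows from the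
-- cardinality but is also recorded.  By uniqueness of finite fields up to
-- isomorphism, quantifying over all such records is quantifying over F_{2^m}.
record FiniteField2 (m : ℕ) : Set₁ where
  infixl 6 _+_
  infixl 7 _*_
  field
    Carrier : Set
    _+_ _*_ : Carrier → Carrier → Carrier
    -_      : Carrier → Carrier
    0# 1#   : Carrier
    isCommutativeRing : IsCommutativeRing _≡_ _+_ _*_ -_ 0# 1#
    0≢1     : 0# ≢ 1#
    inverse : ∀ x → x ≢ 0# → Σ Carrier (λ y → x * y ≡ 1#)
    _≟_     : (x y : Carrier) → Dec (x ≡ y)
    elems   : List Carrier
    elems-unique   : Unique elems
    elems-complete : ∀ x → x ∈ elems
    card    : length elems ≡ 2 ℕ.^ m
    char2   : 1# + 1# ≡ 0#

  infixr 8 _^_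
  _^_ : Carrier → ℕ → Carrier
  x ^ zero  = 1#
  x ^ suc k = x * (x ^ k)

  -- Convention 1/0 = 0 : y⁻¹ := y^(2^m - 2)
  inv : Carrier → Carrier
  inv y = y ^ (2 ℕ.^ m ℕ.∸ 2)

  sumF : ℕ → (ℕ → Carrier) → Carrier
  sumF zero    f = 0#
  sumF (suc k) f = sumF k f + f k

  Tr : ℕ → Carrier → Carrier
  Tr k x = sumF k (λ i → x ^ (2 ℕ.^ i))

  -- (-1)^t for t ∈ F_2 ⊂ field (0 ↦ 1, anything else ↦ -1)
  sign : Carrier → ℤ
  sign t with t ≟ 0#
  ... | yes _ = ℤ.+ 1
  ... | no  _ = ℤ.- (ℤ.+ 1)

  -- bit of a field element lying in F_2 (0# ↦ false, otherwise true)
  bit : Carrier → Bool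
  bit t with t ≟ 0#
  ... | yes _ = false
  ... | no  _ = true

  signB : Bool → ℤ
  signB false = ℤ.+ 1
  signB true  = ℤ.- (ℤ.+ 1)

  sumℤ : List Carrier → (Carrier → ℤ) → ℤ
  sumℤ []       g = ℤ.+ 0
  sumℤ (x ∷ xs) g = g x ℤ.+ sumℤ xs g

FCarrier : ∀ {m} → FiniteField2 m → Set
FCarrier F = FiniteField2.Carrier F

module Setup (n : ℕ) (F : FiniteField2 (2 ℕ.* n)) where
  open FiniteField2 F

  q : ℕ
  q = 2 ℕ.^ n

  conj : Carrier → Carrier
  conj x = x ^ q

  InFq : Carrier → Set
  InFq x = x ^ q ≡ x

  InU : Carrier → Set
  InU x = x ^ (q ℕ.+ 1) ≡ 1#

  Tr2n : Carrier → Carrier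
  Tr2n = Tr (2 ℕ.* n)

  Trn : Carrier → Carrier
  Trn = Tr n

  elemsFq : List Carrier
  elemsFq = filter (λ x → (x ^ q) ≟ x) elems

  Kloosterman : Carrier → ℤ
  Kloosterman a = sumℤ elemsFq (λ x → sign (Trn (inv x + a * x)))

  Walsh : (Carrier → Bool) → Carrier → ℤ
  Walsh f ω = sumℤ elems (λ x → signB (f x xor bit (Tr2n (ω * x))))

  Bent : (Carrier → Bool) → Set
  Bent f = ∀ ω → Walsh f ω ℤ.* Walsh f ω ≡ ℤ.+ (2 ℕ.^ (2 ℕ.* n))

  h1 : Carrier → Carrier → Carrier → Bool
  h1 a1 b x = bit (Tr2n (a1 * inv (x ^ (q ℕ.∸ 1) + b)))

  Cond1 : Carrier → Carrier → Set
  Cond1 a1 b = InU b × b ≢ 1# × Tr2n (a1 * inv b) ≡ 0#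

  Cond2 : Carrier → Carrier → Set
  Cond2 a1 b =
    ¬ InU b ×
    Kloosterman (a1 * inv (1# + b * conj b)) ≡ ℤ.+ 0 ×
    Trn (a1 * (b + conj b) * inv ((1# + b * conj b) * (b * conj b))) ≡ 0#

{-# OPTIONS --safe #-}
-- Every x ≠ 0 is uniquely y u with y ∈ 𝔽_q* and u ∈ U, and h₁(y u) = h₁(u).  Put ε = (-1)^h₁(0) and
-- S = Σ_{u ∈ U} (-1)^h₁(u).  Then W(0) = ε - S + q S, and for ω ≠ 0 W(ω) = ε - S + q (-1)^h₁(u), where u is
-- the only element of U with ω u ∈ 𝔽_q.  Hence h₁ is bent if S = ε; conversely W(0) = ±q forces S = ε unless q = 2.
-- As u ↦ u^(q-1) permutes U, S is the sum of χ(a₁/(v + b)) over v ∈ U, with χ = (-1)^Tr.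
--  * If b ∈ U, then v = b (1 + 1/t) with t + t̄ = 1 makes the exponent affine in t, so S = 1 for b ≠ 1 and
--    S = 1 ± q for b = 1.
--  * If b ∉ U, then w = (1 + b b̄)/(v + b) + b̄ permutes U and S = ± Σ_{w ∈ U} (-1)^Tr(c (w + w̄)) with
--    c = a₁/(1 + b b̄).  Writing w = 1 + 1/t we have w + w̄ = 1/(t² + t), and t ↦ t² + t is two-to-one onto the
--    elements of 𝔽_q of trace 1, so the sum is 1 - K(c).  The case K(c) = 2 is excluded by 4 ∣ K(c) for 4 ∣ q.
module Submission where

open import Defs
open import Algebra.Bundles using (CommutativeRing; RawRing)
open import Algebra.Structures using (IsCommutativeMonoid; IsCommutativeRing)
open import Algebra.Solver.Ring.AlmostCommutativeRing using (AlmostCommutativeRing; fromCommutativeRing; _-Raw-AlmostCommutative⟶_)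
import Algebra.Solver.Ring as RingSolver
open import Data.Bool using (Bool; true; false; _xor_; _∧_)
open import Data.Empty using (⊥; ⊥-elim)
open import Data.Integer as ℤ using (ℤ; 0ℤ; 1ℤ; -1ℤ)
import Data.Integer.Properties as ℤ
import Data.Integer.Solver as ℤSolver
open import Data.List using (List; []; _∷_; length; filter; map; cartesianProduct; _++_)
open import Data.List.Membership.Propositional using (_∈_; lose)
open import Data.List.Membership.Propositional.Properties using (∈-filter⁺; ∈-filter⁻; ∈-map⁺; ∈-map⁻; ∈-cartesianProduct⁺; ∈-cartesianProduct⁻)
open import Data.List.Membership.Propositional.Properties.WithK using (unique∧set⇒bag)
open import Data.List.Relation.Binary.BagAndSetEquality using (∼bag⇒↭)
open import Data.List.Relation.Binary.Permutation.Propositional as Perm using (_↭_)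
open import Data.List.Relation.Unary.All as All using ()
import Data.List.Relation.Unary.All.Properties as All
open import Data.List.Relation.Unary.AllPairs using ([]; _∷_)
open import Data.List.Relation.Unary.Any as Any using (here; there; any?)
open import Data.List.Relation.Unary.Unique.Propositional using (Unique)
open import Data.List.Relation.Unary.Unique.Propositional.Properties using () renaming (filter⁺ to unique-filter; cartesianProduct⁺ to unique-cartesianProduct)
open import Data.Maybe using (Maybe; just; nothing)
open import Data.Nat as ℕ using (ℕ; zero; suc; s≤s; z≤n)
import Data.Nat.Divisibility as ℕ
import Data.Nat.Properties as ℕ
open import Data.Product using (∃; _×_; _,_; proj₁; proj₂)
open import Data.Sum as Sum using (_⊎_; inj₁; inj₂; [_,_]′)
open import Function using (_∘_; mk⇔)
open import Level using (0ℓ)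
open import Relation.Binary.Definitions using (tri<; tri≈; tri>)
open import Relation.Binary.PropositionalEquality using (_≡_; _≢_; refl; sym; trans; cong; cong₂; subst; module ≡-Reasoning)
open import Relation.Nullary using (¬_; Dec; yes; no; ¬?; contradiction)
open import Relation.Unary using (Pred; Decidable)

-- Off the circle the equation S = ε is read through signs. There S = δ (1 - K(c)) with δ =
-- (-1)^Tr(c (b + b̄)), the trace being that of 𝔽_q, and partial fractions give ε = δ η, where η is
-- the sign of the second trace in condition (2). So S = ε says 1 - K(c) = η, which leaves K(c) = 0
-- with η = 1, or K(c) = 2 with η = -1.
--
-- The exception q = 2 comes from W(0) = ε + (q - 1) S: a wrong sign would make q - 1 divide 2. For
-- q = 2 the case b ∉ U is void, because U is then all of 𝔽₄*; for b in U and b ≠ 1 the value S = 1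
-- is explicit and W(0) decides ε directly.
--
-- Two sources feed all the bijections. Squaring is bijective in characteristic 2, which yields the
-- polar decomposition (the radius is the root of the norm) and the permutation u ↦ u^(q-1) = ū² of
-- U. One element t₀ with t₀ + t̄₀ = 1, obtained by bounding the roots of x^q + x, yields the order
-- of 𝔽_q, an element of 𝔽_q of trace 1, and the solvability of t² + t = s in 𝔽_{q²} for every s in
-- 𝔽_q.

private
  variable
    A B : Set

-- Bijections between duplicate-free lists, and iterated operations over lists

-- The laws are required on members only, so `to` and `from` can be total formulas that are mutually
-- inverse just there. Every change of variable in a sum is such a record.
record _≅_ (xs : List A) (ys : List B) : Set where
  field
    to        : A → B
    from      : B → A
    to-∈      : ∀ {x} → x ∈ xs → to x ∈ ys
    from-∈    : ∀ {y} → y ∈ ys → from y ∈ xs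
    from∘to   : ∀ {x} → x ∈ xs → from (to x) ≡ x
    to∘from   : ∀ {y} → y ∈ ys → to (from y) ≡ y

unique-map : (f : A → B) {xs : List A} → Unique xs →
             (∀ {x y} → x ∈ xs → y ∈ xs → f x ≡ f y → x ≡ y) → Unique (map f xs)
unique-map f [] inj = []
unique-map f (x∉ ∷ u) inj =
  All.map⁺ (All.tabulate λ y∈ eq → All.lookup x∉ y∈ (inj (here refl) (there y∈) eq))
  ∷ unique-map f u (λ p r → inj (there p) (there r))

-- Without duplicates, equality as sets upgrades to equality as bags, and that is a permutation.
≅⇒map-↭ : {xs : List A} {ys : List B} → Unique xs → Unique ys →
          (e : xs ≅ ys) → map (_≅_.to e) xs ↭ ys
≅⇒map-↭ {xs = xs} {ys} ux uy e =
  ∼bag⇒↭ (unique∧set⇒bag (unique-map to ux inj) uy (mk⇔ fwd bwd))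
  where
  open _≅_ e
  inj : ∀ {x y} → x ∈ xs → y ∈ xs → to x ≡ to y → x ≡ y
  inj p r eq = trans (sym (from∘to p)) (trans (cong from eq) (from∘to r))
  fwd : ∀ {z} → z ∈ map to xs → z ∈ ys
  fwd z∈ with _ , x∈ , refl ← ∈-map⁻ to z∈ = to-∈ x∈
  bwd : ∀ {z} → z ∈ ys → z ∈ map to xs
  bwd z∈ = subst (_∈ map to xs) (to∘from z∈) (∈-map⁺ to (from-∈ z∈))

-- Two monoids are meant: multiplication in the field, for Fermat's theorem, and addition of
-- integers, for the character sums.
module BigOp {M : Set} {_∙_ : M → M → M} {ε : M} (isCM : IsCommutativeMonoid _≡_ _∙_ ε) where
  open IsCommutativeMonoid isCM using (assoc; comm; identityˡ; identityʳ)
  open ≡-Reasoning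

  big : List A → (A → M) → M
  big []       f = ε
  big (x ∷ xs) f = f x ∙ big xs f

  big-cong : ∀ (xs : List A) {f g : A → M} → (∀ {x} → x ∈ xs → f x ≡ g x) → big xs f ≡ big xs g
  big-cong []       eq = refl
  big-cong (x ∷ xs) eq = cong₂ _∙_ (eq (here refl)) (big-cong xs (eq ∘ there))

  big-ε : ∀ (xs : List A) → big xs (λ _ → ε) ≡ ε
  big-ε []       = refl
  big-ε (x ∷ xs) = trans (identityˡ _) (big-ε xs)

  interchange : ∀ a b c d → (a ∙ b) ∙ (c ∙ d) ≡ (a ∙ c) ∙ (b ∙ d)
  interchange a b c d = begin
    (a ∙ b) ∙ (c ∙ d)  ≡⟨ assoc a b (c ∙ d) ⟩
    a ∙ (b ∙ (c ∙ d))  ≡⟨ cong (a ∙_) (sym (assoc b c d)) ⟩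
    a ∙ ((b ∙ c) ∙ d)  ≡⟨ cong (λ z → a ∙ (z ∙ d)) (comm b c) ⟩
    a ∙ ((c ∙ b) ∙ d)  ≡⟨ cong (a ∙_) (assoc c b d) ⟩
    a ∙ (c ∙ (b ∙ d))  ≡⟨ sym (assoc a c (b ∙ d)) ⟩
    (a ∙ c) ∙ (b ∙ d)  ∎

  big-∙ : ∀ (xs : List A) (f g : A → M) → big xs (λ x → f x ∙ g x) ≡ big xs f ∙ big xs g
  big-∙ []       f g = sym (identityˡ ε)
  big-∙ (x ∷ xs) f g =
    trans (cong ((f x ∙ g x) ∙_) (big-∙ xs f g)) (interchange (f x) (g x) _ _)

  big-↭ : ∀ {xs ys : List A} (f : A → M) → xs ↭ ys → big xs f ≡ big ys f
  big-↭ f Perm.refl          = refl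
  big-↭ f (Perm.prep x p)    = cong (f x ∙_) (big-↭ f p)
  big-↭ {xs = _ ∷ _ ∷ xs} {_ ∷ _ ∷ ys} f (Perm.swap x y p) = begin
    f x ∙ (f y ∙ big xs f)  ≡⟨ sym (assoc _ _ _) ⟩
    (f x ∙ f y) ∙ big xs f  ≡⟨ cong₂ _∙_ (comm (f x) (f y)) (big-↭ f p) ⟩
    (f y ∙ f x) ∙ big ys f  ≡⟨ assoc _ _ _ ⟩
    f y ∙ (f x ∙ big ys f)  ∎
  big-↭ f (Perm.trans p r)   = trans (big-↭ f p) (big-↭ f r)

  big-map : ∀ (f : A → B) (xs : List A) (g : B → M) → big (map f xs) g ≡ big xs (g ∘ f)
  big-map f []       g = refl
  big-map f (x ∷ xs) g = cong (g (f x) ∙_) (big-map f xs g)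

  big-++ : ∀ (xs ys : List A) (f : A → M) → big (xs ++ ys) f ≡ big xs f ∙ big ys f
  big-++ []       ys f = sym (identityˡ _)
  big-++ (x ∷ xs) ys f = trans (cong (f x ∙_) (big-++ xs ys f)) (sym (assoc _ _ _))

  big-reindex : ∀ {xs : List A} {ys : List B} → Unique xs → Unique ys → (e : xs ≅ ys) →
                (g : B → M) → big xs (g ∘ _≅_.to e) ≡ big ys g
  big-reindex {xs = xs} ux uy e g =
    trans (sym (big-map (_≅_.to e) xs g)) (big-↭ g (≅⇒map-↭ ux uy e))

  big-cartesianProduct : ∀ (xs : List A) (ys : List B) (f : A × B → M) →
    big (cartesianProduct xs ys) f ≡ big xs (λ x → big ys (λ y → f (x , y)))
  big-cartesianProduct []       ys f = refl
  big-cartesianProduct (x ∷ xs) ys f =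
    trans (big-++ (map (x ,_) ys) _ f)
          (cong₂ _∙_ (big-map (x ,_) ys f) (big-cartesianProduct xs ys f))

  big-swap : ∀ (xs : List A) (ys : List B) (f : A → B → M) →
    big xs (λ x → big ys (f x)) ≡ big ys (λ y → big xs (λ x → f x y))
  big-swap []       ys f = sym (big-ε ys)
  big-swap (x ∷ xs) ys f =
    trans (cong (big ys (f x) ∙_) (big-swap xs ys f)) (sym (big-∙ ys (f x) _))

  big-single : ∀ {xs : List A} {a} → Unique xs → a ∈ xs → (f : A → M) →
               (∀ {x} → x ∈ xs → x ≢ a → f x ≡ ε) → big xs f ≡ f a
  big-single {xs = x ∷ xs} (x∉ ∷ u) (here refl) f off =
    trans (cong (f x ∙_) (trans (big-cong xs λ y∈ → off (there y∈) (All.lookup x∉ y∈ ∘ sym)) (big-ε xs)))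
          (identityʳ _)
  big-single {xs = x ∷ xs} (x∉ ∷ u) (there a∈) f off =
    trans (cong₂ _∙_ (off (here refl) (All.lookup x∉ a∈)) (big-single u a∈ f (off ∘ there)))
          (identityˡ _)

  -- An indicator weight. It turns a sum over a filtered list into one over the whole list, so that
  -- double sums can be exchanged.
  restrict : {P : Set} → Dec P → M → M
  restrict (yes _) m = m
  restrict (no  _) m = ε

  restrict-yes : {P : Set} (d : Dec P) → P → ∀ m → restrict d m ≡ m
  restrict-yes (yes _) p m = refl
  restrict-yes (no ¬p) p m = contradiction p ¬p

  restrict-no : {P : Set} (d : Dec P) → ¬ P → ∀ m → restrict d m ≡ ε
  restrict-no (yes p) ¬p m = contradiction p ¬p
  restrict-no (no _)  ¬p m = refl

  big-filter : ∀ {P : Pred A 0ℓ} (P? : Decidable P) (xs : List A) (f : A → M) →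
               big (filter P? xs) f ≡ big xs (λ x → restrict (P? x) (f x))
  big-filter P? []       f = refl
  big-filter P? (x ∷ xs) f with P? x
  ... | yes _ = cong (f x ∙_) (big-filter P? xs f)
  ... | no  _ = trans (big-filter P? xs f) (sym (identityˡ _))

  big-filter-complement : ∀ {P : Pred A 0ℓ} (P? : Decidable P) (xs : List A) (f : A → M) →
    big xs f ≡ big (filter P? xs) f ∙ big (filter (¬? ∘ P?) xs) f
  big-filter-complement P? xs f = begin
    big xs f
      ≡⟨ big-cong xs (λ {x} _ → split x) ⟩
    big xs (λ x → restrict (P? x) (f x) ∙ restrict (¬? (P? x)) (f x))
      ≡⟨ big-∙ xs _ _ ⟩
    big xs (λ x → restrict (P? x) (f x)) ∙ big xs (λ x → restrict (¬? (P? x)) (f x))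
      ≡⟨ cong₂ _∙_ (sym (big-filter P? xs f)) (sym (big-filter (¬? ∘ P?) xs f)) ⟩
    big (filter P? xs) f ∙ big (filter (¬? ∘ P?) xs) f ∎
    where
    split : ∀ x → f x ≡ restrict (P? x) (f x) ∙ restrict (¬? (P? x)) (f x)
    split x with P? x
    ... | yes _ = sym (identityʳ _)
    ... | no  _ = sym (identityˡ _)

  big-remove : ∀ {P : Pred A 0ℓ} (P? : Decidable P) {xs : List A} {a} → Unique xs → a ∈ xs → P a →
               (∀ {x} → P x → x ≡ a) → (f : A → M) →
               big xs f ≡ f a ∙ big (filter (¬? ∘ P?) xs) f
  big-remove P? {xs} {a} u a∈ pa only f =
    trans (big-filter-complement P? xs f) (cong (_∙ big (filter (¬? ∘ P?) xs) f) (trans (big-filter P? xs f)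
      (trans (big-single u a∈ _ (λ {x} _ x≢a → restrict-no (P? x) (x≢a ∘ only) _)) (restrict-yes (P? a) pa _))))

-- Arithmetic in a field with 2^m elements

module Field {m : ℕ} (F : FiniteField2 m) where
  open FiniteField2 F public
  open IsCommutativeRing isCommutativeRing public
    using (+-assoc; +-comm; +-identityˡ; +-identityʳ; *-assoc; *-comm; *-identityˡ; *-identityʳ; zeroˡ; zeroʳ; distribˡ; distribʳ; *-isCommutativeMonoid; -‿inverseʳ)
  open ≡-Reasoning

  private
    commutativeRing : CommutativeRing 0ℓ 0ℓ
    commutativeRing = record { isCommutativeRing = isCommutativeRing }

  x+x≡0 : ∀ x → x + x ≡ 0#
  x+x≡0 x = begin
    x + x            ≡⟨ cong₂ _+_ (sym (*-identityˡ x)) (sym (*-identityˡ x)) ⟩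
    1# * x + 1# * x  ≡⟨ sym (distribʳ x 1# 1#) ⟩
    (1# + 1#) * x    ≡⟨ cong (_* x) char2 ⟩
    0# * x           ≡⟨ zeroˡ x ⟩
    0#               ∎

  -x≡x : ∀ x → - x ≡ x
  -x≡x x = begin
    - x              ≡⟨ sym (+-identityˡ _) ⟩
    0# + - x         ≡⟨ cong (_+ - x) (sym (x+x≡0 x)) ⟩
    (x + x) + - x    ≡⟨ +-assoc x x (- x) ⟩
    x + (x + - x)    ≡⟨ cong (x +_) (-‿inverseʳ x) ⟩
    x + 0#           ≡⟨ +-identityʳ x ⟩
    x                ∎

  -- Coefficients in 𝔽₂ = (Bool, xor, ∧), so that the ring solver knows that the characteristic is 2.
  module Char₂Solver where
    𝔽₂ : RawRing 0ℓ 0ℓ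
    𝔽₂ = record { Carrier = Bool ; _≈_ = _≡_ ; _+_ = _xor_ ; _*_ = _∧_ ; -_ = λ x → x ; 0# = false ; 1# = true }

    ring : AlmostCommutativeRing 0ℓ 0ℓ
    ring = fromCommutativeRing commutativeRing

    ⟦_⟧₂ : Bool → Carrier
    ⟦ true  ⟧₂ = 1#
    ⟦ false ⟧₂ = 0#

    morphism : 𝔽₂ -Raw-AlmostCommutative⟶ ring
    morphism = record
      { ⟦_⟧ = ⟦_⟧₂
      ; +-homo = λ { true true → sym char2 ; true false → sym (+-identityʳ _) ; false y → sym (+-identityˡ _) }
      ; *-homo = λ { true y → sym (*-identityˡ _) ; false y → sym (zeroˡ _) }
      ; -‿homo = λ _ → sym (-x≡x _)
      ; 0-homo = refl
      ; 1-homo = refl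
      }

    coeff≟ : ∀ a b → Maybe (⟦ a ⟧₂ ≡ ⟦ b ⟧₂)
    coeff≟ true  true  = just refl
    coeff≟ false false = just refl
    coeff≟ _     _     = nothing

    open RingSolver 𝔽₂ ring morphism coeff≟ public using (solve; _:=_; _:+_; _:*_; con)

  open Char₂Solver public using (solve; _:=_; _:+_; _:*_; con)

  +-cancel : ∀ {x y} → x + y ≡ 0# → x ≡ y
  +-cancel {x} {y} eq = begin
    x            ≡⟨ solve 2 (λ x y → x := (x :+ y) :+ y) refl x y ⟩
    (x + y) + y  ≡⟨ cong (_+ y) eq ⟩
    0# + y       ≡⟨ +-identityˡ y ⟩
    y            ∎

  *-cancelˡ : ∀ {x y z} → x ≢ 0# → x * y ≡ x * z → y ≡ z
  *-cancelˡ {x} {y} {z} x≢0 eq with x′ , xx′ ← inverse x x≢0 = begin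
    y             ≡⟨ sym (*-identityˡ y) ⟩
    1# * y        ≡⟨ cong (_* y) (sym xx′) ⟩
    (x * x′) * y  ≡⟨ rot x x′ y ⟩
    x′ * (x * y)  ≡⟨ cong (x′ *_) eq ⟩
    x′ * (x * z)  ≡⟨ sym (rot x x′ z) ⟩
    (x * x′) * z  ≡⟨ cong (_* z) xx′ ⟩
    1# * z        ≡⟨ *-identityˡ z ⟩
    z             ∎
    where
    rot : ∀ a b c → (a * b) * c ≡ b * (a * c)
    rot = solve 3 (λ a b c → (a :* b) :* c := b :* (a :* c)) refl

  x*y≡0⇒y≡0 : ∀ {x y} → x ≢ 0# → x * y ≡ 0# → y ≡ 0#
  x*y≡0⇒y≡0 x≢0 eq = *-cancelˡ x≢0 (trans eq (sym (zeroʳ _)))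

  *-nonzero : ∀ {x y} → x ≢ 0# → y ≢ 0# → x * y ≢ 0#
  *-nonzero x≢0 y≢0 eq = y≢0 (x*y≡0⇒y≡0 x≢0 eq)

  x²≡x⇒x≡0∨1 : ∀ {x} → x * x ≡ x → (x ≡ 0#) ⊎ (x ≡ 1#)
  x²≡x⇒x≡0∨1 {x} eq with x ≟ 0#
  ... | yes x≡0 = inj₁ x≡0
  ... | no x≢0  = inj₂ (*-cancelˡ x≢0 (trans eq (sym (*-identityʳ x))))

  ^-+ : ∀ x j k → x ^ (j ℕ.+ k) ≡ x ^ j * x ^ k
  ^-+ x zero    k = sym (*-identityˡ _)
  ^-+ x (suc j) k = trans (cong (x *_) (^-+ x j k)) (sym (*-assoc _ _ _))

  ^-distrib-* : ∀ x y k → (x * y) ^ k ≡ x ^ k * y ^ k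
  ^-distrib-* x y zero    = sym (*-identityˡ 1#)
  ^-distrib-* x y (suc k) = trans (cong (x * y *_) (^-distrib-* x y k))
    (solve 4 (λ a b c d → a :* b :* (c :* d) := (a :* c) :* (b :* d)) refl x y (x ^ k) (y ^ k))

  1^ : ∀ k → 1# ^ k ≡ 1#
  1^ zero    = refl
  1^ (suc k) = trans (*-identityˡ _) (1^ k)

  ^-* : ∀ x j k → (x ^ j) ^ k ≡ x ^ (j ℕ.* k)
  ^-* x zero    k = 1^ k
  ^-* x (suc j) k = begin
    (x * x ^ j) ^ k        ≡⟨ ^-distrib-* x (x ^ j) k ⟩
    x ^ k * (x ^ j) ^ k    ≡⟨ cong (x ^ k *_) (^-* x j k) ⟩
    x ^ k * x ^ (j ℕ.* k)  ≡⟨ sym (^-+ x k (j ℕ.* k)) ⟩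
    x ^ (suc j ℕ.* k)      ∎

  ^-comm : ∀ x j k → (x ^ j) ^ k ≡ (x ^ k) ^ j
  ^-comm x j k = trans (^-* x j k) (trans (cong (x ^_) (ℕ.*-comm j k)) (sym (^-* x k j)))

  0^ : ∀ {k} → 0 ℕ.< k → 0# ^ k ≡ 0#
  0^ (s≤s _) = zeroˡ _

  ^-nonzero : ∀ {x} k → x ≢ 0# → x ^ k ≢ 0#
  ^-nonzero zero    x≢0 = 0≢1 ∘ sym
  ^-nonzero (suc k) x≢0 = *-nonzero x≢0 (^-nonzero k x≢0)

  infix 9 _^2^_
  _^2^_ : Carrier → ℕ → Carrier
  x ^2^ k = x ^ (2 ℕ.^ k)

  ^2^-zero : ∀ x → x ^2^ 0 ≡ x
  ^2^-zero x = *-identityʳ x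

  ^2^-suc : ∀ x k → x ^2^ suc k ≡ (x * x) ^2^ k
  ^2^-suc x k = trans (sym (^-* x 2 (2 ℕ.^ k))) (cong (λ z → (x * z) ^2^ k) (*-identityʳ x))

  ^2^-suc′ : ∀ x k → x ^2^ suc k ≡ x ^2^ k * x ^2^ k
  ^2^-suc′ x k = trans (^2^-suc x k) (^-distrib-* x x (2 ℕ.^ k))

  ^2^-+ : ∀ x y k → (x + y) ^2^ k ≡ x ^2^ k + y ^2^ k
  ^2^-+ x y zero    = trans (^2^-zero _) (sym (cong₂ _+_ (^2^-zero x) (^2^-zero y)))
  ^2^-+ x y (suc k) = begin
    (x + y) ^2^ suc k                        ≡⟨ ^2^-suc′ (x + y) k ⟩
    (x + y) ^2^ k * (x + y) ^2^ k            ≡⟨ cong (λ z → z * z) (^2^-+ x y k) ⟩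
    (x ^2^ k + y ^2^ k) * (x ^2^ k + y ^2^ k)
      ≡⟨ solve 2 (λ a b → (a :+ b) :* (a :+ b) := a :* a :+ b :* b) refl (x ^2^ k) (y ^2^ k) ⟩
    x ^2^ k * x ^2^ k + y ^2^ k * y ^2^ k    ≡⟨ sym (cong₂ _+_ (^2^-suc′ x k) (^2^-suc′ y k)) ⟩
    x ^2^ suc k + y ^2^ suc k                ∎

  0^2^ : ∀ k → 0# ^2^ k ≡ 0#
  0^2^ k = 0^ (ℕ.m^n>0 2 k)

  nonzeros : List Carrier
  nonzeros = filter (¬? ∘ (_≟ 0#)) elems

  nonzeros-unique : Unique nonzeros
  nonzeros-unique = unique-filter (¬? ∘ (_≟ 0#)) elems-unique

  ∈-nonzeros : ∀ {x} → x ≢ 0# → x ∈ nonzeros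
  ∈-nonzeros x≢0 = ∈-filter⁺ (¬? ∘ (_≟ 0#)) (elems-complete _) x≢0

  nonzeros-≢0 : ∀ {x} → x ∈ nonzeros → x ≢ 0#
  nonzeros-≢0 x∈ = proj₂ (∈-filter⁻ (¬? ∘ (_≟ 0#)) {xs = elems} x∈)

  private
    module Π = BigOp *-isCommutativeMonoid

  Π-const : ∀ (xs : List Carrier) x → Π.big xs (λ _ → x) ≡ x ^ length xs
  Π-const []       x = refl
  Π-const (_ ∷ xs) x = cong (x *_) (Π-const xs x)

  Π-nonzero : ∀ xs → (∀ {x} → x ∈ xs → x ≢ 0#) → Π.big xs (λ x → x) ≢ 0#
  Π-nonzero []       ne = 0≢1 ∘ sym
  Π-nonzero (x ∷ xs) ne = *-nonzero (ne (here refl)) (Π-nonzero xs (ne ∘ there))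

  scale : ∀ {x} → x ≢ 0# → nonzeros ≅ nonzeros
  scale {x} x≢0 with x′ , xx′ ← inverse x x≢0 = record
    { to = x *_ ; from = x′ *_
    ; to-∈ = λ y∈ → ∈-nonzeros (*-nonzero x≢0 (nonzeros-≢0 y∈))
    ; from-∈ = λ y∈ → ∈-nonzeros (*-nonzero x′≢0 (nonzeros-≢0 y∈))
    ; from∘to = λ _ → cancel (trans (*-comm x′ x) xx′)
    ; to∘from = λ _ → cancel xx′ }
    where
    x′≢0 : x′ ≢ 0#
    x′≢0 refl = 0≢1 (trans (sym (zeroʳ x)) xx′)
    cancel : ∀ {a b c} → a * b ≡ 1# → a * (b * c) ≡ c
    cancel {c = c} eq = trans (sym (*-assoc _ _ _)) (trans (cong (_* c) eq) (*-identityˡ c))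

  -- Multiplication by x permutes the nonzero elements, so their product absorbs one factor x per
  -- element; being nonzero, it cancels.
  Π-nonzeros-const : ∀ {x} → x ≢ 0# → Π.big nonzeros (λ _ → x) ≡ 1#
  Π-nonzeros-const {x} x≢0 = *-cancelˡ (Π-nonzero nonzeros nonzeros-≢0) (begin
    Π.big nonzeros (λ y → y) * Π.big nonzeros (λ _ → x)  ≡⟨ *-comm _ _ ⟩
    Π.big nonzeros (λ _ → x) * Π.big nonzeros (λ y → y)  ≡⟨ sym (Π.big-∙ nonzeros _ _) ⟩
    Π.big nonzeros (λ y → x * y)
      ≡⟨ Π.big-reindex nonzeros-unique nonzeros-unique (scale x≢0) (λ y → y) ⟩
    Π.big nonzeros (λ y → y)                             ≡⟨ sym (*-identityʳ _) ⟩
    Π.big nonzeros (λ y → y) * 1#                        ∎)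

  -- x^(2^m) is a product of copies of x indexed by all elements. Splitting off the index `0#`
  -- leaves the product over `nonzeros`, which is 1; this avoids counting that list.
  fermat : ∀ x → x ^2^ m ≡ x
  fermat x with x ≟ 0#
  ... | yes refl = 0^2^ m
  ... | no x≢0   = begin
    x ^2^ m                              ≡⟨ cong (x ^_) (sym card) ⟩
    x ^ length elems                     ≡⟨ sym (Π-const elems x) ⟩
    Π.big elems (λ _ → x)
      ≡⟨ Π.big-remove (_≟ 0#) elems-unique (elems-complete 0#) refl (λ eq → eq) _ ⟩
    x * Π.big nonzeros (λ _ → x)         ≡⟨ cong (x *_) (Π-nonzeros-const x≢0) ⟩
    x * 1#                               ≡⟨ *-identityʳ x ⟩
    x                                    ∎

  inv-* : ∀ x y → inv (x * y) ≡ inv x * inv y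
  inv-* x y = ^-distrib-* x y (2 ℕ.^ m ℕ.∸ 2)

  -- Monic polynomial functions and the number of their roots

  -- A polynomial is its function together with a Horner scheme, which is exactly what division by a
  -- linear factor recurses on.
  data Monic : ℕ → (Carrier → Carrier) → Set where
    one  : ∀ {f} → (∀ x → f x ≡ 1#) → Monic 0 f
    step : ∀ {d f g} c → Monic d g → (∀ x → f x ≡ c + x * g x) → Monic (suc d) f

  monic-^ : ∀ d → Monic d (_^ d)
  monic-^ zero    = one (λ _ → refl)
  monic-^ (suc d) = step 0# (monic-^ d) (λ _ → sym (+-identityˡ _))

  -- Synthetic division: if g has quotient k at r, then c + x g(x) has quotient g(r) + x k(x). In
  -- characteristic 2 the factor x - r is `x + r`.
  divide : ∀ {d f} → Monic (suc d) f → ∀ r → ∃ λ g → Monic d g × (∀ x → f x ≡ f r + (x + r) * g x)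
  divide {f = f} (step {g = g} c (one g≡1) f≡) r = (λ _ → 1#) , one (λ _ → refl) , λ x → begin
    f x                          ≡⟨ trans (f≡ x) (cong (λ z → c + x * z) (g≡1 x)) ⟩
    c + x * 1#                   ≡⟨ solve 3 (λ c x r → c :+ x :* con true := (c :+ r :* con true) :+ (x :+ r) :* con true) refl c x r ⟩
    (c + r * 1#) + (x + r) * 1#  ≡⟨ cong (_+ (x + r) * 1#) (sym (trans (f≡ r) (cong (λ z → c + r * z) (g≡1 r)))) ⟩
    f r + (x + r) * 1#           ∎
  divide {f = f} (step {g = g} c mg@(step _ _ _) f≡) r with k , mk , g≡ ← divide mg r =
    (λ x → g r + x * k x) , step (g r) mk (λ _ → refl) , λ x → begin
    f x                                              ≡⟨ trans (f≡ x) (cong (λ z → c + x * z) (g≡ x)) ⟩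
    c + x * (g r + (x + r) * k x)
      ≡⟨ solve 5 (λ c x r u v → c :+ x :* (u :+ (x :+ r) :* v) := (c :+ r :* u) :+ (x :+ r) :* (u :+ x :* v)) refl c x r (g r) (k x) ⟩
    (c + r * g r) + (x + r) * (g r + x * k x)        ≡⟨ cong (_+ (x + r) * (g r + x * k x)) (sym (f≡ r)) ⟩
    f r + (x + r) * (g r + x * k x)                  ∎

  -- Divide by the first root r; every other listed root differs from r, so it annihilates the
  -- quotient, whose degree is one less.
  roots≤degree : ∀ {d f} → Monic d f → ∀ {xs} → Unique xs → (∀ {x} → x ∈ xs → f x ≡ 0#) → length xs ℕ.≤ d
  roots≤degree mf {[]} u root = z≤n
  roots≤degree (one f≡1) {x ∷ xs} u root = ⊥-elim (0≢1 (trans (sym (root (here refl))) (f≡1 x)))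
  roots≤degree {f = f} mf@(step _ _ _) {r ∷ xs} (r∉ ∷ u) root with g , mg , f≡ ← divide mf r =
    s≤s (roots≤degree mg u λ {x} x∈ → x*y≡0⇒y≡0 (λ x+r≡0 → All.lookup r∉ x∈ (sym (+-cancel x+r≡0))) (begin
      (x + r) * g x         ≡⟨ sym (+-identityˡ _) ⟩
      0# + (x + r) * g x    ≡⟨ cong (_+ (x + r) * g x) (sym (root (here refl))) ⟩
      f r + (x + r) * g x   ≡⟨ sym (f≡ x) ⟩
      f x                   ≡⟨ root (there x∈) ⟩
      0#                    ∎))

  -- Traces

  Tr-+ : ∀ k x y → Tr k (x + y) ≡ Tr k x + Tr k y
  Tr-+ zero    x y = sym (+-identityʳ 0#)
  Tr-+ (suc k) x y = trans (cong₂ _+_ (Tr-+ k x y) (^2^-+ x y k))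
    (solve 4 (λ a b c d → (a :+ b) :+ (c :+ d) := (a :+ c) :+ (b :+ d)) refl (Tr k x) (Tr k y) (x ^2^ k) (y ^2^ k))

  Tr-² : ∀ k x → Tr k (x * x) ≡ Tr k x * Tr k x
  Tr-² zero    x = sym (zeroˡ 0#)
  Tr-² (suc k) x = trans (cong₂ _+_ (Tr-² k x) (^-distrib-* x x (2 ℕ.^ k)))
    (solve 2 (λ a b → a :* a :+ b :* b := (a :+ b) :* (a :+ b)) refl (Tr k x) (x ^2^ k))

  -- Consecutive Frobenius powers cancel in pairs. This yields both that traces take values in {0,
  -- 1} and that t² + t has trace t + t̄.
  Tr-telescope : ∀ k x → Tr k (x * x + x) ≡ x ^2^ k + x
  Tr-telescope zero    x = trans (sym (x+x≡0 x)) (cong (_+ x) (sym (^2^-zero x)))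
  Tr-telescope (suc k) x = begin
    Tr k (x * x + x) + (x * x + x) ^2^ k
      ≡⟨ cong₂ _+_ (Tr-telescope k x) (^2^-+ (x * x) x k) ⟩
    (x ^2^ k + x) + ((x * x) ^2^ k + x ^2^ k)
      ≡⟨ solve 3 (λ a b c → (a :+ b) :+ (c :+ a) := c :+ b) refl (x ^2^ k) x ((x * x) ^2^ k) ⟩
    (x * x) ^2^ k + x
      ≡⟨ cong (_+ x) (sym (^2^-suc x k)) ⟩
    x ^2^ suc k + x ∎

  -- T = Tr(x) satisfies T² + T = x^(2^k) + x = 0. The hypothesis `fix` lets the same statement
  -- serve the trace from a subfield.
  Tr∈𝔽₂ : ∀ k {x} → x ^2^ k ≡ x → (Tr k x ≡ 0#) ⊎ (Tr k x ≡ 1#)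
  Tr∈𝔽₂ k {x} fix = x²≡x⇒x≡0∨1 (+-cancel (begin
    Tr k x * Tr k x + Tr k x  ≡⟨ cong (_+ Tr k x) (sym (Tr-² k x)) ⟩
    Tr k (x * x) + Tr k x     ≡⟨ sym (Tr-+ k (x * x) x) ⟩
    Tr k (x * x + x)          ≡⟨ Tr-telescope k x ⟩
    x ^2^ k + x               ≡⟨ cong (_+ x) fix ⟩
    x + x                     ≡⟨ x+x≡0 x ⟩
    0#                        ∎))

  -- For j = k = n this is transitivity of the trace through 𝔽_q; for j = 1 it is the recursion of
  -- `Tr-suc`.
  Tr-split : ∀ j k x → Tr (k ℕ.+ j) x ≡ Tr j x + Tr k (x ^2^ j)
  Tr-split j zero    x = sym (+-identityʳ _)
  Tr-split j (suc k) x = begin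
    Tr (k ℕ.+ j) x + x ^2^ (k ℕ.+ j)
      ≡⟨ cong₂ _+_ (Tr-split j k x)
          (trans (cong (x ^_) (trans (cong (2 ℕ.^_) (ℕ.+-comm k j)) (ℕ.^-distribˡ-+-* 2 j k))) (sym (^-* x (2 ℕ.^ j) (2 ℕ.^ k)))) ⟩
    (Tr j x + Tr k (x ^2^ j)) + (x ^2^ j) ^2^ k
      ≡⟨ +-assoc _ _ _ ⟩
    Tr j x + Tr (suc k) (x ^2^ j) ∎

  -- Additive Hilbert 90: with Y = Σ_{i<k} Tr_i(s) θ^(2^i), the sum Y² + Y telescopes.
  hilbert90-sum : Carrier → Carrier → ℕ → Carrier
  hilbert90-sum s θ k = sumF k (λ i → Tr i s * θ ^2^ i)

  Tr-suc : ∀ k s → Tr (suc k) s ≡ s + Tr k s * Tr k s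
  Tr-suc k s = begin
    Tr (suc k) s              ≡⟨ cong (λ j → Tr j s) (sym (ℕ.+-comm k 1)) ⟩
    Tr (k ℕ.+ 1) s            ≡⟨ Tr-split 1 k s ⟩
    Tr 1 s + Tr k (s ^ 2)     ≡⟨ cong₂ _+_ (trans (+-identityˡ _) (^2^-zero s)) (trans (cong (Tr k ∘ (s *_)) (*-identityʳ s)) (Tr-² k s)) ⟩
    s + Tr k s * Tr k s       ∎

  -- A step adds P² t² + P t, with P = Tr_k(s) and t = θ^(2^k). The old boundary term P t cancels,
  -- and s + P² = Tr_{k+1}(s) supplies the new one.
  hilbert90-telescope : ∀ s θ k → let Y = hilbert90-sum s θ k in
    Y * Y + Y ≡ Tr k s * θ ^2^ k + s * (Tr k θ * Tr k θ)
  hilbert90-telescope s θ zero =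
    solve 2 (λ s t → con false :* con false :+ con false := con false :* t :+ s :* (con false :* con false)) refl s (θ ^2^ 0)
  hilbert90-telescope s θ (suc k) = begin
    (Y + P * t) * (Y + P * t) + (Y + P * t)
      ≡⟨ solve 3 (λ Y P t → (Y :+ P :* t) :* (Y :+ P :* t) :+ (Y :+ P :* t)
                           := (Y :* Y :+ Y) :+ ((P :* P) :* (t :* t) :+ P :* t)) refl Y P t ⟩
    (Y * Y + Y) + ((P * P) * (t * t) + P * t)
      ≡⟨ cong (_+ ((P * P) * (t * t) + P * t)) (hilbert90-telescope s θ k) ⟩
    (P * t + s * (T * T)) + ((P * P) * (t * t) + P * t)
      ≡⟨ solve 4 (λ P t s T → (P :* t :+ s :* (T :* T)) :+ ((P :* P) :* (t :* t) :+ P :* t)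
                 := (s :+ P :* P) :* (t :* t) :+ s :* ((T :+ t) :* (T :+ t))) refl P t s T ⟩
    (s + P * P) * (t * t) + s * ((T + t) * (T + t))
      ≡⟨ cong₂ (λ u v → u * v + s * ((T + t) * (T + t))) (sym (Tr-suc k s)) (sym (^2^-suc′ θ k)) ⟩
    Tr (suc k) s * θ ^2^ suc k + s * (Tr (suc k) θ * Tr (suc k) θ) ∎
    where
    Y = hilbert90-sum s θ k
    P = Tr k s
    T = Tr k θ
    t = θ ^2^ k

  hilbert90 : ∀ {k s θ} → Tr k s ≡ 0# → Tr k θ ≡ 1# → ∃ λ y → y * y + y ≡ s
  hilbert90 {k} {s} {θ} s≡0 θ≡1 = hilbert90-sum s θ k , (begin
    _                                          ≡⟨ hilbert90-telescope s θ k ⟩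
    Tr k s * θ ^2^ k + s * (Tr k θ * Tr k θ)   ≡⟨ cong₂ (λ u v → u * θ ^2^ k + s * (v * v)) s≡0 θ≡1 ⟩
    0# * θ ^2^ k + s * (1# * 1#)
      ≡⟨ solve 2 (λ s t → con false :* t :+ s :* (con true :* con true) := s) refl s (θ ^2^ k) ⟩
    s                                          ∎)

-- Integer sums

module ℤS = ℤSolver.+-*-Solver

module ∑ = BigOp ℤ.+-0-isCommutativeMonoid
open ∑ using () renaming (big to ∑)

module _ {A : Set} where
  open ≡-Reasoning

  ∑-*ˡ : ∀ (xs : List A) c (f : A → ℤ) → ∑ xs (λ x → c ℤ.* f x) ≡ c ℤ.* ∑ xs f
  ∑-*ˡ []       c f = sym (ℤ.*-zeroʳ c)
  ∑-*ˡ (x ∷ xs) c f = trans (cong (λ z → (c ℤ.* f x) ℤ.+ z) (∑-*ˡ xs c f)) (sym (ℤ.*-distribˡ-+ c (f x) (∑ xs f)))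

  ∑-*ʳ : ∀ (xs : List A) c (f : A → ℤ) → ∑ xs (λ x → f x ℤ.* c) ≡ ∑ xs f ℤ.* c
  ∑-*ʳ xs c f = trans (∑.big-cong xs (λ {x} _ → ℤ.*-comm (f x) c)) (trans (∑-*ˡ xs c f) (ℤ.*-comm c _))

  ∑-1 : ∀ (xs : List A) → ∑ xs (λ _ → 1ℤ) ≡ ℤ.+ length xs
  ∑-1 []       = refl
  ∑-1 (x ∷ xs) = cong (λ z → 1ℤ ℤ.+ z) (∑-1 xs)

  ∑-const : ∀ (xs : List A) c → ∑ xs (λ _ → c) ≡ ℤ.+ length xs ℤ.* c
  ∑-const xs c = begin
    ∑ xs (λ _ → c)          ≡⟨ ∑.big-cong xs (λ _ → sym (ℤ.*-identityˡ c)) ⟩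
    ∑ xs (λ _ → 1ℤ ℤ.* c)   ≡⟨ ∑-*ʳ xs c (λ _ → 1ℤ) ⟩
    ∑ xs (λ _ → 1ℤ) ℤ.* c   ≡⟨ cong (ℤ._* c) (∑-1 xs) ⟩
    ℤ.+ length xs ℤ.* c     ∎

i≡-i⇒i≡0 : ∀ {i} → i ≡ ℤ.- i → i ≡ 0ℤ
i≡-i⇒i≡0 {ℤ.+ zero}    eq = refl
i≡-i⇒i≡0 {ℤ.+ suc _}   ()
i≡-i⇒i≡0 {ℤ.-[1+ _ ]}  ()

m*m≡n*n⇒m≡n : ∀ {m n} → m ℕ.* m ≡ n ℕ.* n → m ≡ n
m*m≡n*n⇒m≡n {m} {n} eq with ℕ.<-cmp m n
... | tri< m<n _ _ = contradiction eq (ℕ.<⇒≢ (ℕ.*-mono-< m<n m<n))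
... | tri≈ _ m≡n _ = m≡n
... | tri> _ _ n<m = contradiction (sym eq) (ℕ.<⇒≢ (ℕ.*-mono-< n<m n<m))

-- The extension of 𝔽_q of degree 2: inversion, conjugation, unit circle, square roots

module Quadratic (n : ℕ) (n≥1 : n ℕ.≥ 1) (F : FiniteField2 (2 ℕ.* n)) where
  open Field F public
  open Setup n F public
  open ≡-Reasoning

  2≤q : 2 ℕ.≤ q
  2≤q = ℕ.^-monoʳ-≤ 2 n≥1

  q² : 2 ℕ.^ (2 ℕ.* n) ≡ q ℕ.* q
  q² = trans (cong (λ k → 2 ℕ.^ (n ℕ.+ k)) (ℕ.+-identityʳ n)) (ℕ.^-distribˡ-+-* 2 n n)

  4≤q² : 4 ℕ.≤ 2 ℕ.^ (2 ℕ.* n)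
  4≤q² = subst (4 ℕ.≤_) (sym q²) (ℕ.*-mono-≤ 2≤q 2≤q)

  -- The exponent 2^(2n) - 2 is positive because n ≥ 1; with exponent 0 the value would be `1#`.
  inv-0 : inv 0# ≡ 0#
  inv-0 = 0^ (ℕ.≤-trans (s≤s z≤n) (ℕ.∸-monoˡ-≤ 2 4≤q²))

  x*inv[x]≡1 : ∀ {x} → x ≢ 0# → x * inv x ≡ 1#
  x*inv[x]≡1 {x} x≢0 = *-cancelˡ x≢0 (begin
    x ^ (2 ℕ.+ (2 ℕ.^ (2 ℕ.* n) ℕ.∸ 2))  ≡⟨ cong (x ^_) (ℕ.m+[n∸m]≡n (ℕ.≤-trans (s≤s (s≤s z≤n)) 4≤q²)) ⟩
    x ^ (2 ℕ.^ (2 ℕ.* n))                ≡⟨ fermat x ⟩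
    x                                    ≡⟨ sym (*-identityʳ x) ⟩
    x * 1#                               ∎)

  xy≡1⇒x≢0 : ∀ {x y} → x * y ≡ 1# → x ≢ 0#
  xy≡1⇒x≢0 {y = y} eq refl = 0≢1 (trans (sym (zeroˡ y)) eq)

  xy≡1⇒inv[x]≡y : ∀ {x y} → x * y ≡ 1# → inv x ≡ y
  xy≡1⇒inv[x]≡y eq = *-cancelˡ (xy≡1⇒x≢0 eq) (trans (x*inv[x]≡1 (xy≡1⇒x≢0 eq)) (sym eq))

  inv-≢0 : ∀ {x} → x ≢ 0# → inv x ≢ 0#
  inv-≢0 x≢0 = ^-nonzero (2 ℕ.^ (2 ℕ.* n) ℕ.∸ 2) x≢0

  -- By the convention 1/0 = 0 this holds at 0 too, so inversion permutes all of 𝔽_q and may be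
  -- substituted in Kloosterman sums.
  inv-inv : ∀ x → inv (inv x) ≡ x
  inv-inv x with x ≟ 0#
  ... | yes refl = trans (cong inv inv-0) inv-0
  ... | no x≢0   = xy≡1⇒inv[x]≡y (trans (*-comm _ _) (x*inv[x]≡1 x≢0))

  x*[y*inv[x]]≡y : ∀ {x} y → x ≢ 0# → x * (y * inv x) ≡ y
  x*[y*inv[x]]≡y {x} y x≢0 = begin
    x * (y * inv x)  ≡⟨ solve 3 (λ x y i → x :* (y :* i) := y :* (x :* i)) refl x y (inv x) ⟩
    y * (x * inv x)  ≡⟨ cong (y *_) (x*inv[x]≡1 x≢0) ⟩
    y * 1#           ≡⟨ *-identityʳ y ⟩
    y                ∎

  [x*y]*inv[x]≡y : ∀ {x} y → x ≢ 0# → (x * y) * inv x ≡ y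
  [x*y]*inv[x]≡y y x≢0 = trans (*-assoc _ _ _) (x*[y*inv[x]]≡y y x≢0)

  conj-+ : ∀ x y → conj (x + y) ≡ conj x + conj y
  conj-+ x y = ^2^-+ x y n

  conj-* : ∀ x y → conj (x * y) ≡ conj x * conj y
  conj-* x y = ^-distrib-* x y q

  conj-0 : conj 0# ≡ 0#
  conj-0 = 0^2^ n

  conj-1 : conj 1# ≡ 1#
  conj-1 = 1^ q

  conj-^ : ∀ x k → conj (x ^ k) ≡ conj x ^ k
  conj-^ x k = ^-comm x k q

  conj-inv : ∀ x → conj (inv x) ≡ inv (conj x)
  conj-inv x = conj-^ x (2 ℕ.^ (2 ℕ.* n) ℕ.∸ 2)

  conj-conj : ∀ x → conj (conj x) ≡ x
  conj-conj x = trans (^-* x q q) (trans (cong (x ^_) (sym q²)) (fermat x))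

  Fq-+ : ∀ {x y} → InFq x → InFq y → InFq (x + y)
  Fq-+ {x} {y} px py = trans (conj-+ x y) (cong₂ _+_ px py)

  Fq-* : ∀ {x y} → InFq x → InFq y → InFq (x * y)
  Fq-* {x} {y} px py = trans (conj-* x y) (cong₂ _*_ px py)

  Fq-^ : ∀ {x} k → InFq x → InFq (x ^ k)
  Fq-^ {x} k px = trans (conj-^ x k) (cong (_^ k) px)

  Fq-inv : ∀ {x} → InFq x → InFq (inv x)
  Fq-inv {x} px = Fq-^ (2 ℕ.^ (2 ℕ.* n) ℕ.∸ 2) px

  Fq-x+x̄ : ∀ x → InFq (x + conj x)
  Fq-x+x̄ x = trans (conj-+ x (conj x)) (trans (cong (conj x +_) (conj-conj x)) (+-comm _ _))

  Fq-xx̄ : ∀ x → InFq (x * conj x)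
  Fq-xx̄ x = trans (conj-* x (conj x)) (trans (cong (conj x *_) (conj-conj x)) (*-comm _ _))

  x^[q+1]≡xx̄ : ∀ x → x ^ (q ℕ.+ 1) ≡ x * conj x
  x^[q+1]≡xx̄ x = trans (cong (x ^_) (ℕ.+-comm q 1)) refl

  InU⇒ : ∀ {x} → InU x → x * conj x ≡ 1#
  InU⇒ {x} p = trans (sym (x^[q+1]≡xx̄ x)) p

  ⇒InU : ∀ {x} → x * conj x ≡ 1# → InU x
  ⇒InU {x} p = trans (x^[q+1]≡xx̄ x) p

  U-≢0 : ∀ {x} → InU x → x ≢ 0#
  U-≢0 p = xy≡1⇒x≢0 (InU⇒ p)

  U-inv : ∀ {x} → InU x → inv x ≡ conj x
  U-inv p = xy≡1⇒inv[x]≡y (InU⇒ p)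

  U-* : ∀ {x y} → InU x → InU y → InU (x * y)
  U-* {x} {y} px py = trans (^-distrib-* x y (q ℕ.+ 1)) (trans (cong₂ _*_ px py) (*-identityˡ 1#))

  U-^ : ∀ {x} k → InU x → InU (x ^ k)
  U-^ {x} k px = trans (^-comm x k (q ℕ.+ 1)) (trans (cong (_^ k) px) (1^ k))

  U-conj : ∀ {x} → InU x → InU (conj x)
  U-conj = U-^ q

  U-1 : InU 1#
  U-1 = 1^ (q ℕ.+ 1)

  x²≡1⇒x≡1 : ∀ {x} → x * x ≡ 1# → x ≡ 1#
  x²≡1⇒x≡1 {x} eq = +-cancel (case ((x + 1#) ≟ 0#))
    where
    sq : (x + 1#) * (x + 1#) ≡ 0#
    sq = begin
      (x + 1#) * (x + 1#)  ≡⟨ solve 1 (λ x → (x :+ con true) :* (x :+ con true) := x :* x :+ con true) refl x ⟩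
      x * x + 1#           ≡⟨ cong (_+ 1#) eq ⟩
      1# + 1#              ≡⟨ char2 ⟩
      0#                   ∎
    case : Dec (x + 1# ≡ 0#) → x + 1# ≡ 0#
    case (yes p) = p
    case (no ¬p) = x*y≡0⇒y≡0 ¬p sq

  -- Here 1 = x x̄ = x², and 1 is its own only square root in characteristic 2. This gives the
  -- uniqueness of the u with ω u in 𝔽_q.
  U∩Fq : ∀ {x} → InU x → InFq x → x ≡ 1#
  U∩Fq {x} u f = x²≡1⇒x≡1 (trans (cong (x *_) (sym f)) (InU⇒ u))

  -- Frobenius iterated 2n - 1 times: by Fermat, one more squaring is the identity.
  sqrt : Carrier → Carrier
  sqrt x = x ^2^ (2 ℕ.* n ℕ.∸ 1)

  suc[2n∸1] : suc (2 ℕ.* n ℕ.∸ 1) ≡ 2 ℕ.* n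
  suc[2n∸1] = ℕ.m+[n∸m]≡n (ℕ.≤-trans n≥1 (ℕ.m≤m+n n _))

  sqrt-sqrt : ∀ x → sqrt x * sqrt x ≡ x
  sqrt-sqrt x = trans (sym (^2^-suc′ x (2 ℕ.* n ℕ.∸ 1))) (trans (cong (x ^2^_) suc[2n∸1]) (fermat x))

  sqrt-² : ∀ x → sqrt (x * x) ≡ x
  sqrt-² x = trans (sym (^2^-suc x (2 ℕ.* n ℕ.∸ 1))) (trans (cong (x ^2^_) suc[2n∸1]) (fermat x))

  -- The lists of 𝔽_q, U and 𝔽_q*, and the order of 𝔽_q

  Fqs Us Fq*s : List Carrier
  Fqs  = elemsFq
  Us   = filter (λ x → (x ^ (q ℕ.+ 1)) ≟ 1#) elems
  Fq*s = filter (¬? ∘ (_≟ 0#)) Fqs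

  Fqs-unique : Unique Fqs
  Fqs-unique = unique-filter _ elems-unique

  Us-unique : Unique Us
  Us-unique = unique-filter _ elems-unique

  Fq*s-unique : Unique Fq*s
  Fq*s-unique = unique-filter _ Fqs-unique

  ∈Fqs : ∀ {x} → InFq x → x ∈ Fqs
  ∈Fqs p = ∈-filter⁺ _ (elems-complete _) p

  Fqs∋ : ∀ {x} → x ∈ Fqs → InFq x
  Fqs∋ x∈ = proj₂ (∈-filter⁻ (λ x → (x ^ q) ≟ x) {xs = elems} x∈)

  ∈Us : ∀ {x} → InU x → x ∈ Us
  ∈Us p = ∈-filter⁺ _ (elems-complete _) p

  Us∋ : ∀ {x} → x ∈ Us → InU x
  Us∋ x∈ = proj₂ (∈-filter⁻ (λ x → (x ^ (q ℕ.+ 1)) ≟ 1#) {xs = elems} x∈)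

  ∈Fq*s : ∀ {x} → InFq x → x ≢ 0# → x ∈ Fq*s
  ∈Fq*s p x≢0 = ∈-filter⁺ (¬? ∘ (_≟ 0#)) (∈Fqs p) x≢0

  Fq*s∋ : ∀ {x} → x ∈ Fq*s → InFq x × x ≢ 0#
  Fq*s∋ x∈ with p , x≢0 ← ∈-filter⁻ (¬? ∘ (_≟ 0#)) {xs = Fqs} x∈ = Fqs∋ p , x≢0

  Fq-0 : InFq 0#
  Fq-0 = conj-0

  -- Otherwise x^q + x, monic of degree q, would have all q² > q elements as roots.
  ∃x̄≢x : ∃ λ x → conj x ≢ x
  ∃x̄≢x with any? (λ x → ¬? (conj x ≟ x)) elems
  ... | yes p = Any.satisfied p
  ... | no ¬p = contradiction
      (subst (ℕ._≤ q) (trans card q²) (roots≤degree monic elems-unique λ {x} x∈ → root x (fixed x∈)))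
      (ℕ.<⇒≱ (ℕ.m<m*n q q {{ℕ.>-nonZero (ℕ.≤-trans (s≤s z≤n) 2≤q)}} 2≤q))
    where
    fixed : ∀ {x} → x ∈ elems → conj x ≡ x
    fixed {x} x∈ with conj x ≟ x
    ... | yes eq = eq
    ... | no neq = contradiction (lose x∈ neq) ¬p
    root : ∀ x → conj x ≡ x → conj x + x ≡ 0#
    root x eq = trans (cong (_+ x) eq) (x+x≡0 x)
    2+[q∸2] : 2 ℕ.+ (q ℕ.∸ 2) ≡ q
    2+[q∸2] = ℕ.m+[n∸m]≡n 2≤q
    -- Writing q as 2 + (q - 2) exposes the two lowest Horner steps, with coefficients 0 and 1, of
    -- x^q + x = x (1 + x x^(q-2)).
    monic′ : Monic (2 ℕ.+ (q ℕ.∸ 2)) (λ x → conj x + x)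
    monic′ = step {g = λ x → 1# + x * x ^ (q ℕ.∸ 2)} 0# (step 1# (monic-^ (q ℕ.∸ 2)) (λ _ → refl)) λ x → trans
      (cong (λ k → x ^ k + x) (sym 2+[q∸2]))
      (solve 2 (λ x y → x :* (x :* y) :+ x := con false :+ x :* (con true :+ x :* y)) refl x (x ^ (q ℕ.∸ 2)))
    monic : Monic q (λ x → conj x + x)
    monic = subst (λ k → Monic k (λ x → conj x + x)) 2+[q∸2] monic′

  -- For z not fixed by conjugation, c = z + z̄ is a nonzero element of 𝔽_q; dividing z by it
  -- normalises the relative trace to 1.
  ∃x+x̄≡1 : ∃ λ t → t + conj t ≡ 1#
  ∃x+x̄≡1 with z , z̄≢z ← ∃x̄≢x = z * inv c , (begin
    z * inv c + conj (z * inv c)        ≡⟨ cong (z * inv c +_) (trans (conj-* z (inv c)) (cong (conj z *_) (Fq-inv (Fq-x+x̄ z)))) ⟩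
    z * inv c + conj z * inv c          ≡⟨ sym (distribʳ (inv c) z (conj z)) ⟩
    c * inv c                           ≡⟨ x*inv[x]≡1 (λ c≡0 → z̄≢z (sym (+-cancel c≡0))) ⟩
    1#                                  ∎)
    where c = z + conj z

  -- Fixed once for all: 1 and `t₀` form a basis over 𝔽_q, and `t₀` + 𝔽_q is the set of all t with t
  -- + t̄ = 1.
  t₀ : Carrier
  t₀ = proj₁ ∃x+x̄≡1

  t₀+t̄₀ : t₀ + conj t₀ ≡ 1#
  t₀+t̄₀ = proj₂ ∃x+x̄≡1

  x̄≡x+[x+x̄] : ∀ x → conj x ≡ x + (x + conj x)
  x̄≡x+[x+x̄] x = solve 2 (λ x y → y := x :+ (x :+ y)) refl x (conj x)

  t̄₀ : conj t₀ ≡ t₀ + 1#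
  t̄₀ = trans (x̄≡x+[x+x̄] t₀) (cong (t₀ +_) t₀+t̄₀)

  -- Coordinates in the basis 1, `t₀`. Since t₀ + t̄₀ = 1, the relative trace of y + z t₀ is z, and
  -- it reads off the second coordinate.
  Fq²≅F : cartesianProduct Fqs Fqs ≅ elems
  Fq²≅F = record
    { to      = λ (y , z) → y + z * t₀
    ; from    = λ x → (x + (x + conj x) * t₀) , (x + conj x)
    ; to-∈    = λ _ → elems-complete _
    ; from-∈  = λ {x} _ → ∈-cartesianProduct⁺ (∈Fqs (fix x)) (∈Fqs (Fq-x+x̄ x))
    ; from∘to = λ {p} p∈ → let y∈ , z∈ = ∈-cartesianProduct⁻ Fqs Fqs p∈ in left (Fqs∋ y∈) (Fqs∋ z∈)
    ; to∘from = λ {x} _ → solve 2 (λ x w → (x :+ w) :+ w := x) refl x ((x + conj x) * t₀)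
    }
    where
    fix : ∀ x → InFq (x + (x + conj x) * t₀)
    fix x = begin
      conj (x + c * t₀)            ≡⟨ trans (conj-+ _ _) (cong (conj x +_) (trans (conj-* c t₀) (cong₂ _*_ (Fq-x+x̄ x) t̄₀))) ⟩
      conj x + c * (t₀ + 1#)       ≡⟨ solve 3 (λ x y t → y :+ (x :+ y) :* (t :+ con true) := x :+ (x :+ y) :* t) refl x (conj x) t₀ ⟩
      x + c * t₀                   ∎
      where c = x + conj x
    tr : ∀ {y z} → InFq y → InFq z → (y + z * t₀) + conj (y + z * t₀) ≡ z
    tr {y} {z} py pz = begin
      (y + z * t₀) + conj (y + z * t₀)      ≡⟨ cong ((y + z * t₀) +_) (trans (conj-+ y (z * t₀)) (cong₂ _+_ py (trans (conj-* z t₀) (cong₂ _*_ pz t̄₀)))) ⟩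
      (y + z * t₀) + (y + z * (t₀ + 1#))    ≡⟨ solve 3 (λ y z t → (y :+ z :* t) :+ (y :+ z :* (t :+ con true)) := z) refl y z t₀ ⟩
      z                                     ∎
    left : ∀ {y z} → InFq y → InFq z →
      ((y + z * t₀) + ((y + z * t₀) + conj (y + z * t₀)) * t₀ , (y + z * t₀) + conj (y + z * t₀)) ≡ (y , z)
    left {y} {z} py pz = cong₂ _,_
      (trans (cong (λ c → (y + z * t₀) + c * t₀) (tr py pz)) (solve 2 (λ y w → (y :+ w) :+ w := y) refl y (z * t₀)))
      (tr py pz)

  -- Both sides of `Fq²≅F` are counted as sums of ones, so L² = q² for the length L.
  ∣Fq∣ : length Fqs ≡ q
  ∣Fq∣ = m*m≡n*n⇒m≡n (ℤ.+-injective (begin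
    ℤ.+ (L ℕ.* L)                                ≡⟨ ℤ.pos-* L L ⟩
    ℤ.+ L ℤ.* ℤ.+ L                              ≡⟨ sym (∑-const Fqs (ℤ.+ L)) ⟩
    ∑ Fqs (λ _ → ℤ.+ L)                          ≡⟨ ∑.big-cong Fqs (λ _ → sym (∑-1 Fqs)) ⟩
    ∑ Fqs (λ _ → ∑ Fqs (λ _ → 1ℤ))               ≡⟨ sym (∑.big-cartesianProduct Fqs Fqs (λ _ → 1ℤ)) ⟩
    ∑ (cartesianProduct Fqs Fqs) (λ _ → 1ℤ)
      ≡⟨ ∑.big-reindex (unique-cartesianProduct Fqs-unique Fqs-unique) elems-unique Fq²≅F (λ _ → 1ℤ) ⟩
    ∑ elems (λ _ → 1ℤ)                           ≡⟨ ∑-1 elems ⟩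
    ℤ.+ length elems                             ≡⟨ cong ℤ.+_ (trans card q²) ⟩
    ℤ.+ (q ℕ.* q)                                ∎))
    where L = length Fqs

  -- Signs and characters

  sign-0 : ∀ {t} → t ≡ 0# → sign t ≡ 1ℤ
  sign-0 {t} t≡0 with t ≟ 0#
  ... | yes _  = refl
  ... | no t≢0 = contradiction t≡0 t≢0

  sign-≢0 : ∀ {t} → t ≢ 0# → sign t ≡ -1ℤ
  sign-≢0 {t} t≢0 with t ≟ 0#
  ... | yes t≡0 = contradiction t≡0 t≢0
  ... | no _    = refl

  sign-1 : ∀ {t} → t ≡ 1# → sign t ≡ -1ℤ
  sign-1 refl = sign-≢0 (0≢1 ∘ sym)

  sign-± : ∀ t → (sign t ≡ 1ℤ) ⊎ (sign t ≡ -1ℤ)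
  sign-± t with t ≟ 0#
  ... | yes _ = inj₁ refl
  ... | no  _ = inj₂ refl

  sign≡1⇒≡0 : ∀ {t} → sign t ≡ 1ℤ → t ≡ 0#
  sign≡1⇒≡0 {t} eq with t ≟ 0#
  ... | yes t≡0 = t≡0
  ... | no _    = contradiction eq λ ()

  signB-bit : ∀ t → signB (bit t) ≡ sign t
  signB-bit t with t ≟ 0#
  ... | yes _ = refl
  ... | no  _ = refl

  signB-xor : ∀ x y → signB (x xor y) ≡ signB x ℤ.* signB y
  signB-xor true  true  = refl
  signB-xor true  false = refl
  signB-xor false y     = sym (ℤ.*-identityˡ _)

  -- `sign` maps everything except `0#` to -1, so multiplicativity needs values in {0, 1}; traces
  -- supply them through `Tr∈𝔽₂`.
  sign-+ : ∀ {s t} → (s ≡ 0#) ⊎ (s ≡ 1#) → (t ≡ 0#) ⊎ (t ≡ 1#) → sign (s + t) ≡ sign s ℤ.* sign t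
  sign-+ {t = t} (inj₁ refl) _ = trans (cong sign (+-identityˡ t)) (sym (trans (cong (ℤ._* sign t) (sign-0 refl)) (ℤ.*-identityˡ _)))
  sign-+ {s} _ (inj₁ refl) = trans (cong sign (+-identityʳ s)) (sym (trans (cong (sign s ℤ.*_) (sign-0 refl)) (ℤ.*-identityʳ _)))
  sign-+ (inj₂ refl) (inj₂ refl) = trans (sign-0 char2) (sym (cong₂ ℤ._*_ (sign-1 refl) (sign-1 refl)))

  -- The canonical additive characters: `ψ` on 𝔽_q and `χ` on 𝔽_{q²}.
  ψ χ : Carrier → ℤ
  ψ y = sign (Trn y)
  χ x = sign (Tr2n x)

  ψ-+ : ∀ {x y} → InFq x → InFq y → ψ (x + y) ≡ ψ x ℤ.* ψ y
  ψ-+ {x} {y} px py = trans (cong sign (Tr-+ n x y)) (sign-+ (Tr∈𝔽₂ n px) (Tr∈𝔽₂ n py))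

  Tr2n≡Trn : ∀ x → Tr2n x ≡ Trn (x + conj x)
  Tr2n≡Trn x = begin
    Tr (n ℕ.+ (n ℕ.+ 0)) x    ≡⟨ cong (λ k → Tr (n ℕ.+ k) x) (ℕ.+-identityʳ n) ⟩
    Tr (n ℕ.+ n) x            ≡⟨ Tr-split n n x ⟩
    Trn x + Trn (conj x)      ≡⟨ sym (Tr-+ n x (conj x)) ⟩
    Trn (x + conj x)          ∎

  χ≡ψ : ∀ x → χ x ≡ ψ (x + conj x)
  χ≡ψ x = cong sign (Tr2n≡Trn x)

  Tr-0 : ∀ k → Tr k 0# ≡ 0#
  Tr-0 zero    = refl
  Tr-0 (suc k) = trans (cong₂ _+_ (Tr-0 k) (0^2^ k)) (+-identityʳ 0#)

  ψ-0 : ∀ {x} → x ≡ 0# → ψ x ≡ 1ℤ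
  ψ-0 refl = sign-0 (Tr-0 n)

  Tr[x²+x] : ∀ t → Trn (t * t + t) ≡ t + conj t
  Tr[x²+x] t = trans (Tr-telescope n t) (+-comm _ _)

  -- Relative trace 1 means t̄ = t + 1. Thus t² + t is the norm of t, which is why it lies in 𝔽_q.
  T-tt̄ : ∀ {t} → t + conj t ≡ 1# → t * conj t ≡ t * t + t
  T-tt̄ {t} eq = trans (cong (t *_) (trans (x̄≡x+[x+x̄] t) (cong (t +_) eq))) (solve 1 (λ t → t :* (t :+ con true) := t :* t :+ t) refl t)

  Fq-t²+t : ∀ {t} → t + conj t ≡ 1# → InFq (t * t + t)
  Fq-t²+t {t} eq = subst InFq (T-tt̄ eq) (Fq-xx̄ t)

  -- The norm of `t₀`. It is an element of 𝔽_q with trace 1, the witness that `ψ` is nontrivial.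
  s₀ : Carrier
  s₀ = t₀ * t₀ + t₀

  Fq-s₀ : InFq s₀
  Fq-s₀ = Fq-t²+t t₀+t̄₀

  Trn-s₀ : Trn s₀ ≡ 1#
  Trn-s₀ = trans (Tr[x²+x] t₀) t₀+t̄₀

  -- The relative trace of s₀ t₀ is s₀, of trace 1. This product is the θ for Hilbert 90 over
  -- 𝔽_{q²}.
  Tr2n-s₀t₀ : Tr2n (s₀ * t₀) ≡ 1#
  Tr2n-s₀t₀ = trans (Tr2n≡Trn (s₀ * t₀)) (trans (cong Trn (begin
    s₀ * t₀ + conj (s₀ * t₀)   ≡⟨ cong (s₀ * t₀ +_) (trans (conj-* s₀ t₀) (cong₂ _*_ Fq-s₀ t̄₀)) ⟩
    s₀ * t₀ + s₀ * (t₀ + 1#)   ≡⟨ solve 2 (λ s t → s :* t :+ s :* (t :+ con true) := s) refl s₀ t₀ ⟩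
    s₀                         ∎)) Trn-s₀)

  -- From 𝔽_{q²}, an element s of 𝔽_q has trace Trn(s + s) = 0, so a solution t exists in 𝔽_{q²}
  -- whatever Trn(s) is; by `Tr[x²+x]`, Trn(s) equals t + t̄.
  artinSchreier : ∀ {s} → InFq s → ∃ λ t → t * t + t ≡ s
  artinSchreier {s} ps = hilbert90 {2 ℕ.* n}
    (trans (Tr2n≡Trn s) (trans (cong Trn (trans (cong (s +_) ps) (x+x≡0 s))) (Tr-0 n))) Tr2n-s₀t₀

  translate : ∀ {c} → InFq c → Fqs ≅ Fqs
  translate {c} pc = record
    { to = _+ c ; from = _+ c
    ; to-∈ = λ y∈ → ∈Fqs (Fq-+ (Fqs∋ y∈) pc) ; from-∈ = λ y∈ → ∈Fqs (Fq-+ (Fqs∋ y∈) pc)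
    ; from∘to = λ {y} _ → invol y ; to∘from = λ {y} _ → invol y }
    where
    invol : ∀ y → (y + c) + c ≡ y
    invol y = solve 2 (λ y c → (y :+ c) :+ c := y) refl y c

  -- Translating y by c = s₀/a adds s₀ to the argument and flips every sign, so the sum equals its
  -- own negative.
  ∑ψ≡0 : ∀ {a} → InFq a → a ≢ 0# → ∑ Fqs (λ y → ψ (y * a)) ≡ 0ℤ
  ∑ψ≡0 {a} pa a≢0 = i≡-i⇒i≡0 (begin
    ∑ Fqs (λ y → ψ (y * a))
      ≡⟨ sym (∑.big-reindex Fqs-unique Fqs-unique (translate pc) (λ y → ψ (y * a))) ⟩
    ∑ Fqs (λ y → ψ ((y + c) * a))
      ≡⟨ ∑.big-cong Fqs (λ y∈ → flip (Fqs∋ y∈)) ⟩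
    ∑ Fqs (λ y → -1ℤ ℤ.* ψ (y * a))
      ≡⟨ ∑-*ˡ Fqs -1ℤ (λ y → ψ (y * a)) ⟩
    -1ℤ ℤ.* ∑ Fqs (λ y → ψ (y * a))
      ≡⟨ ℤ.-1*i≡-i _ ⟩
    ℤ.- ∑ Fqs (λ y → ψ (y * a)) ∎)
    where
    c = s₀ * inv a
    pc = Fq-* Fq-s₀ (Fq-inv pa)
    flip : ∀ {y} → InFq y → ψ ((y + c) * a) ≡ -1ℤ ℤ.* ψ (y * a)
    flip {y} py = begin
      ψ ((y + c) * a)
        ≡⟨ cong ψ (trans (solve 3 (λ y c a → (y :+ c) :* a := a :* c :+ y :* a) refl y c a) (cong (_+ y * a) (x*[y*inv[x]]≡y s₀ a≢0))) ⟩
      ψ (s₀ + y * a)       ≡⟨ ψ-+ Fq-s₀ (Fq-* py pa) ⟩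
      ψ s₀ ℤ.* ψ (y * a)   ≡⟨ cong (ℤ._* ψ (y * a)) (sign-1 Trn-s₀) ⟩
      -1ℤ ℤ.* ψ (y * a)    ∎

  ∑ψ : ∀ {a} → InFq a → ∑ Fqs (λ y → ψ (y * a)) ≡ ∑.restrict (a ≟ 0#) (ℤ.+ q)
  ∑ψ {a} pa with a ≟ 0#
  ... | no a≢0   = ∑ψ≡0 pa a≢0
  ... | yes refl = begin
    ∑ Fqs (λ y → ψ (y * 0#))  ≡⟨ ∑.big-cong Fqs (λ {y} _ → ψ-0 (zeroʳ y)) ⟩
    ∑ Fqs (λ _ → 1ℤ)          ≡⟨ ∑-1 Fqs ⟩
    ℤ.+ length Fqs            ≡⟨ cong ℤ.+_ ∣Fq∣ ⟩
    ℤ.+ q                     ∎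

  ∑*ψ : ∀ {a} → InFq a → ∑ Fq*s (λ y → ψ (y * a)) ≡ ∑.restrict (a ≟ 0#) (ℤ.+ q) ℤ.- 1ℤ
  ∑*ψ {a} pa = begin
    R                          ≡⟨ lem R ⟩
    (1ℤ ℤ.+ R) ℤ.- 1ℤ          ≡⟨ cong (λ z → (z ℤ.+ R) ℤ.- 1ℤ) (sym (ψ-0 (zeroˡ a))) ⟩
    (ψ (0# * a) ℤ.+ R) ℤ.- 1ℤ  ≡⟨ cong (ℤ._- 1ℤ) (sym (∑.big-remove (_≟ 0#) Fqs-unique (∈Fqs Fq-0) refl (λ eq → eq) (λ y → ψ (y * a)))) ⟩
    ∑ Fqs (λ y → ψ (y * a)) ℤ.- 1ℤ  ≡⟨ cong (ℤ._- 1ℤ) (∑ψ pa) ⟩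
    ∑.restrict (a ≟ 0#) (ℤ.+ q) ℤ.- 1ℤ ∎
    where
    R = ∑ Fq*s (λ y → ψ (y * a))
    lem : ∀ r → r ≡ (1ℤ ℤ.+ r) ℤ.- 1ℤ
    lem = ℤS.solve 1 (λ r → r ℤS.:= (ℤS.con 1ℤ ℤS.:+ r) ℤS.:- ℤS.con 1ℤ) refl

  sumℤ≡∑ : ∀ xs g → sumℤ xs g ≡ ∑ xs g
  sumℤ≡∑ []       g = refl
  sumℤ≡∑ (x ∷ xs) g = cong (λ z → g x ℤ.+ z) (sumℤ≡∑ xs g)

  -- Polar decomposition and Walsh sums of functions constant on rays

  -- As y u has norm y², the radius must be the square root of the norm. That root is unique, and
  -- being a power of the norm it stays in 𝔽_q.
  polar : cartesianProduct Us Fq*s ≅ nonzeros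
  polar = record
    { to      = λ (u , y) → y * u
    ; from    = λ x → x * inv (ρ x) , ρ x
    ; to-∈    = λ p∈ → let u∈ , y∈ = ∈-cartesianProduct⁻ Us Fq*s p∈ in
                  ∈-nonzeros (*-nonzero (proj₂ (Fq*s∋ y∈)) (U-≢0 (Us∋ u∈)))
    ; from-∈  = λ {x} x∈ → ∈-cartesianProduct⁺ (∈Us (dir∈U (nonzeros-≢0 x∈))) (∈Fq*s (Fq-^ (2 ℕ.^ (2 ℕ.* n ℕ.∸ 1)) (Fq-xx̄ x)) (ρ≢0 (nonzeros-≢0 x∈)))
    ; from∘to = λ {p} p∈ → let u∈ , y∈ = ∈-cartesianProduct⁻ Us Fq*s p∈ in left (Us∋ u∈) (Fq*s∋ y∈)
    ; to∘from = λ {x} x∈ → x*[y*inv[x]]≡y x (ρ≢0 (nonzeros-≢0 x∈))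
    }
    where
    ρ : Carrier → Carrier
    ρ x = sqrt (x * conj x)
    ρ≢0 : ∀ {x} → x ≢ 0# → ρ x ≢ 0#
    ρ≢0 x≢0 = ^-nonzero (2 ℕ.^ (2 ℕ.* n ℕ.∸ 1)) (*-nonzero x≢0 (^-nonzero q x≢0))
    dir∈U : ∀ {x} → x ≢ 0# → InU (x * inv (ρ x))
    dir∈U {x} x≢0 = ⇒InU (begin
      (x * i) * conj (x * i)        ≡⟨ cong ((x * i) *_) (trans (conj-* x i) (cong (conj x *_) (Fq-inv (Fq-^ (2 ℕ.^ (2 ℕ.* n ℕ.∸ 1)) (Fq-xx̄ x))))) ⟩
      (x * i) * (conj x * i)        ≡⟨ solve 3 (λ x y i → (x :* i) :* (y :* i) := (x :* y) :* (i :* i)) refl x (conj x) i ⟩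
      (x * conj x) * (i * i)        ≡⟨ cong (_* (i * i)) (sym (sqrt-sqrt (x * conj x))) ⟩
      (ρ x * ρ x) * (i * i)         ≡⟨ solve 2 (λ r i → (r :* r) :* (i :* i) := (r :* i) :* (r :* i)) refl (ρ x) i ⟩
      (ρ x * i) * (ρ x * i)         ≡⟨ cong (λ z → z * z) (x*inv[x]≡1 (ρ≢0 x≢0)) ⟩
      1# * 1#                       ≡⟨ *-identityˡ 1# ⟩
      1#                            ∎)
      where i = inv (ρ x)
    ρ-yu : ∀ {u y} → InU u → InFq y → ρ (y * u) ≡ y
    ρ-yu {u} {y} pu py = trans (cong sqrt (begin
      (y * u) * conj (y * u)      ≡⟨ cong ((y * u) *_) (trans (conj-* y u) (cong (_* conj u) py)) ⟩
      (y * u) * (y * conj u)      ≡⟨ solve 3 (λ y u v → (y :* u) :* (y :* v) := (y :* y) :* (u :* v)) refl y u (conj u) ⟩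
      (y * y) * (u * conj u)      ≡⟨ cong ((y * y) *_) (InU⇒ pu) ⟩
      (y * y) * 1#                ≡⟨ *-identityʳ _ ⟩
      y * y                       ∎)) (sqrt-² y)
    left : ∀ {u y} → InU u → InFq y × y ≢ 0# → ((y * u) * inv (ρ (y * u)) , ρ (y * u)) ≡ (u , y)
    left {u} {y} pu (py , y≢0) = cong₂ _,_
      (trans (cong (λ r → (y * u) * inv r) (ρ-yu pu py)) ([x*y]*inv[x]≡y u y≢0)) (ρ-yu pu py)

  χ-yx : ∀ {y} x → InFq y → χ (y * x) ≡ ψ (y * (x + conj x))
  χ-yx {y} x py = trans (χ≡ψ (y * x)) (cong ψ (trans (cong (y * x +_) (trans (conj-* y x) (cong (_* conj x) py))) (sym (distribˡ y x (conj x)))))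

  χ-0 : ∀ {x} → x ≡ 0# → χ x ≡ 1ℤ
  χ-0 refl = sign-0 (Tr-0 (2 ℕ.* n))

  orthogonal : (ω u : Carrier) → Dec (ω * u + conj (ω * u) ≡ 0#)
  orthogonal ω u = (ω * u + conj (ω * u)) ≟ 0#

  -- On the ray through u the value f(u) comes out, and what remains is a sum over y ≠ 0 of ψ(y r)
  -- with r = ω u + conj(ω u). It is q - 1 if r = 0, that is if ω u lies in 𝔽_q, and -1 otherwise.
  walsh-coset : (f : Carrier → ℤ) → (∀ {u y} → InU u → InFq y → y ≢ 0# → f (y * u) ≡ f u) → ∀ ω →
    ∑ elems (λ x → f x ℤ.* χ (ω * x)) ≡
    (f 0# ℤ.- ∑ Us f) ℤ.+ ℤ.+ q ℤ.* ∑ Us (λ u → ∑.restrict (orthogonal ω u) (f u))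
  walsh-coset f f-coset ω = begin
    ∑ elems g
      ≡⟨ ∑.big-remove (_≟ 0#) elems-unique (elems-complete 0#) refl (λ eq → eq) g ⟩
    g 0# ℤ.+ ∑ nonzeros g
      ≡⟨ cong₂ ℤ._+_ (trans (cong (f 0# ℤ.*_) (χ-0 (zeroʳ ω))) (ℤ.*-identityʳ (f 0#)))
           (sym (∑.big-reindex (unique-cartesianProduct Us-unique Fq*s-unique) nonzeros-unique polar g)) ⟩
    f 0# ℤ.+ ∑ (cartesianProduct Us Fq*s) (λ (u , y) → g (y * u))
      ≡⟨ cong (λ z → f 0# ℤ.+ z) (∑.big-cartesianProduct Us Fq*s (λ (u , y) → g (y * u))) ⟩
    f 0# ℤ.+ ∑ Us (λ u → ∑ Fq*s (λ y → g (y * u)))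
      ≡⟨ cong (λ z → f 0# ℤ.+ z) (∑.big-cong Us (λ u∈ → inner (Us∋ u∈))) ⟩
    f 0# ℤ.+ ∑ Us (λ u → ℤ.+ q ℤ.* R u ℤ.+ -1ℤ ℤ.* f u)
      ≡⟨ cong (λ z → f 0# ℤ.+ z) (trans (∑.big-∙ Us _ _) (cong₂ ℤ._+_ (∑-*ˡ Us (ℤ.+ q) R) (∑-*ˡ Us -1ℤ f))) ⟩
    f 0# ℤ.+ (ℤ.+ q ℤ.* ∑ Us R ℤ.+ -1ℤ ℤ.* ∑ Us f)
      ≡⟨ ℤS.solve 3 (λ a b c → a ℤS.:+ (b ℤS.:+ ℤS.con -1ℤ ℤS.:* c) ℤS.:= (a ℤS.:- c) ℤS.:+ b) refl (f 0#) (ℤ.+ q ℤ.* ∑ Us R) (∑ Us f) ⟩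
    (f 0# ℤ.- ∑ Us f) ℤ.+ ℤ.+ q ℤ.* ∑ Us R ∎
    where
    g : Carrier → ℤ
    g x = f x ℤ.* χ (ω * x)
    R : Carrier → ℤ
    R u = ∑.restrict (orthogonal ω u) (f u)
    restrict-q : ∀ {P : Set} (d : Dec P) m → m ℤ.* (∑.restrict d (ℤ.+ q) ℤ.- 1ℤ) ≡ ℤ.+ q ℤ.* ∑.restrict d m ℤ.+ -1ℤ ℤ.* m
    restrict-q (yes _) m = ℤS.solve 2 (λ m q → m ℤS.:* (q ℤS.:- ℤS.con 1ℤ) ℤS.:= q ℤS.:* m ℤS.:+ ℤS.con -1ℤ ℤS.:* m) refl m (ℤ.+ q)
    restrict-q (no _)  m = ℤS.solve 2 (λ m q → m ℤS.:* (ℤS.con 0ℤ ℤS.:- ℤS.con 1ℤ) ℤS.:= q ℤS.:* ℤS.con 0ℤ ℤS.:+ ℤS.con -1ℤ ℤS.:* m) refl m (ℤ.+ q)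
    inner : ∀ {u} → InU u → ∑ Fq*s (λ y → g (y * u)) ≡ ℤ.+ q ℤ.* R u ℤ.+ -1ℤ ℤ.* f u
    inner {u} pu = begin
      ∑ Fq*s (λ y → g (y * u))
        ≡⟨ ∑.big-cong Fq*s (λ {y} y∈ → let py , y≢0 = Fq*s∋ y∈ in cong₂ ℤ._*_ (f-coset pu py y≢0)
             (trans (cong χ (solve 3 (λ w y u → w :* (y :* u) := y :* (w :* u)) refl ω y u)) (χ-yx (ω * u) py))) ⟩
      ∑ Fq*s (λ y → f u ℤ.* ψ (y * (ω * u + conj (ω * u))))
        ≡⟨ ∑-*ˡ Fq*s (f u) (λ y → ψ (y * (ω * u + conj (ω * u)))) ⟩
      f u ℤ.* ∑ Fq*s (λ y → ψ (y * (ω * u + conj (ω * u))))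
        ≡⟨ cong (f u ℤ.*_) (∑*ψ (Fq-x+x̄ (ω * u))) ⟩
      f u ℤ.* (∑.restrict (orthogonal ω u) (ℤ.+ q) ℤ.- 1ℤ)
        ≡⟨ restrict-q (orthogonal ω u) (f u) ⟩
      ℤ.+ q ℤ.* R u ℤ.+ -1ℤ ℤ.* f u ∎

  ∑-orthogonal-0 : ∀ (f : Carrier → ℤ) → ∑ Us (λ u → ∑.restrict (orthogonal 0# u) (f u)) ≡ ∑ Us f
  ∑-orthogonal-0 f = ∑.big-cong Us λ {u} _ → ∑.restrict-yes (orthogonal 0# u)
    (trans (cong (λ z → z + conj z) (zeroˡ u)) (trans (cong (0# +_) conj-0) (+-identityʳ 0#))) (f u)

  ∃-polar : ∀ {ω} → ω ≢ 0# → ∃ λ u → ∃ λ y → InU u × InFq y × y ≢ 0# × y * u ≡ ω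
  ∃-polar {ω} ω≢0 =
    let u , y = _≅_.from polar ω
        u∈ , y∈ = ∈-cartesianProduct⁻ Us Fq*s (_≅_.from-∈ polar (∈-nonzeros ω≢0))
    in u , y , Us∋ u∈ , proj₁ (Fq*s∋ y∈) , proj₂ (Fq*s∋ y∈) , _≅_.to∘from polar (∈-nonzeros ω≢0)

  -- For ω = y v, the product ω u lies in 𝔽_q exactly when v u does; v u being on the circle, this
  -- forces v u = 1, so u = v̄.
  ∑-orthogonal-polar : ∀ {v y} → InU v → InFq y → y ≢ 0# → ∀ (f : Carrier → ℤ) →
                       ∑ Us (λ u → ∑.restrict (orthogonal (y * v) u) (f u)) ≡ f (conj v)
  ∑-orthogonal-polar {v} {y} pv py y≢0 f = trans
    (∑.big-single Us-unique (∈Us (U-conj pv)) (λ u → ∑.restrict (orthogonal (y * v) u) (f u))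
      (λ {u} u∈ u≢v̄ → ∑.restrict-no (orthogonal (y * v) u) (u≢v̄ ∘ only (Us∋ u∈)) (f u)))
    (∑.restrict-yes (orthogonal (y * v) (conj v)) holds (f (conj v)))
    where
    yvv̄ : (y * v) * conj v ≡ y
    yvv̄ = trans (*-assoc _ _ _) (trans (cong (y *_) (InU⇒ pv)) (*-identityʳ y))
    holds : (y * v) * conj v + conj ((y * v) * conj v) ≡ 0#
    holds = trans (cong (λ z → z + conj z) yvv̄) (trans (cong (y +_) py) (x+x≡0 y))
    only : ∀ {u} → InU u → (y * v) * u + conj ((y * v) * u) ≡ 0# → u ≡ conj v
    only {u} pu eq = *-cancelˡ (U-≢0 pv) (trans (U∩Fq (U-* pv pu) vu∈Fq) (sym (InU⇒ pv)))
      where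
      vu∈Fq : InFq (v * u)
      vu∈Fq = *-cancelˡ y≢0 (begin
        y * conj (v * u)       ≡⟨ cong (_* conj (v * u)) (sym py) ⟩
        conj y * conj (v * u)  ≡⟨ sym (conj-* y (v * u)) ⟩
        conj (y * (v * u))     ≡⟨ cong conj (sym (*-assoc y v u)) ⟩
        conj ((y * v) * u)     ≡⟨ sym (+-cancel eq) ⟩
        (y * v) * u            ≡⟨ *-assoc y v u ⟩
        y * (v * u)            ∎)

  ∑-orthogonal : ∀ {ω} → ω ≢ 0# → ∃ λ v → ∀ (f : Carrier → ℤ) →
                 ∑ Us (λ u → ∑.restrict (orthogonal ω u) (f u)) ≡ f v
  ∑-orthogonal ω≢0 =
    let v , y , pv , py , y≢0 , yv≡ω = ∃-polar ω≢0
    in conj v , subst (λ ω → ∀ (f : Carrier → ℤ) → ∑ Us (λ u → ∑.restrict (orthogonal ω u) (f u)) ≡ f (conj v))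
                  yv≡ω (∑-orthogonal-polar pv py y≢0)

  -- Sums over the unit circle

  U-≢1 : List Carrier
  U-≢1 = filter (¬? ∘ (_≟ 1#)) Us

  Ts : List Carrier
  Ts = filter (λ t → (t + conj t) ≟ 1#) elems

  ∈Ts : ∀ {t} → t + conj t ≡ 1# → t ∈ Ts
  ∈Ts p = ∈-filter⁺ _ (elems-complete _) p

  Ts∋ : ∀ {t} → t ∈ Ts → t + conj t ≡ 1#
  Ts∋ t∈ = proj₂ (∈-filter⁻ (λ t → (t + conj t) ≟ 1#) {xs = elems} t∈)

  Ts-unique : Unique Ts
  Ts-unique = unique-filter _ elems-unique

  U-≢1-unique : Unique U-≢1
  U-≢1-unique = unique-filter _ Us-unique

  T-≢0 : ∀ {t} → t + conj t ≡ 1# → t ≢ 0#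
  T-≢0 eq refl = 0≢1 (trans (sym (trans (cong (0# +_) conj-0) (+-identityʳ 0#))) eq)

  -- 1/t + 1/t̄ = (t + t̄)/(t t̄)
  T-inv : ∀ {t} → t + conj t ≡ 1# → inv t + conj (inv t) ≡ inv (t * t + t)
  T-inv {t} eq = sym (trans (cong inv (sym (T-tt̄ eq))) (xy≡1⇒inv[x]≡y (begin
    (t * conj t) * (inv t + conj (inv t))   ≡⟨ cong (λ z → (t * conj t) * (inv t + z)) (conj-inv t) ⟩
    (t * conj t) * (inv t + inv (conj t))
      ≡⟨ solve 4 (λ t s i j → (t :* s) :* (i :+ j) := s :* (t :* i) :+ t :* (s :* j)) refl t (conj t) (inv t) (inv (conj t)) ⟩
    conj t * (t * inv t) + t * (conj t * inv (conj t))
      ≡⟨ cong₂ (λ a b → conj t * a + t * b) (x*inv[x]≡1 (T-≢0 eq)) (x*inv[x]≡1 (^-nonzero q (T-≢0 eq))) ⟩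
    conj t * 1# + t * 1#  ≡⟨ solve 2 (λ t s → s :* con true :+ t :* con true := t :+ s) refl t (conj t) ⟩
    t + conj t            ≡⟨ eq ⟩
    1#                    ∎)))

  -- With i = 1/t, the norm (1 + i)(1 + ī) is 1 exactly when i + ī = i ī, and multiplication by t t̄
  -- turns this into t + t̄ = 1. The circle without the point 1 thus becomes an affine line over
  -- 𝔽_q.
  Ts≅U-≢1 : Ts ≅ U-≢1
  Ts≅U-≢1 = record
    { to      = λ t → 1# + inv t
    ; from    = λ w → inv (1# + w)
    ; to-∈    = λ t∈ → ∈-filter⁺ (¬? ∘ (_≟ 1#)) (∈Us (inU (Ts∋ t∈))) (≢1 (Ts∋ t∈))
    ; from-∈  = λ w∈ → let w∈U , w≢1 = ∈-filter⁻ (¬? ∘ (_≟ 1#)) {xs = Us} w∈ in ∈Ts (inT (Us∋ w∈U) w≢1)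
    ; from∘to = λ {t} _ → trans (cong inv (1+[1+x] (inv t))) (inv-inv t)
    ; to∘from = λ {w} _ → trans (cong (1# +_) (inv-inv (1# + w))) (1+[1+x] w)
    }
    where
    1+[1+x] : ∀ x → 1# + (1# + x) ≡ x
    1+[1+x] x = solve 1 (λ x → con true :+ (con true :+ x) := x) refl x
    ≢1 : ∀ {t} → t + conj t ≡ 1# → 1# + inv t ≢ 1#
    ≢1 {t} eq p = inv-≢0 (T-≢0 eq) (begin
      inv t              ≡⟨ sym (1+[1+x] (inv t)) ⟩
      1# + (1# + inv t)  ≡⟨ cong (1# +_) p ⟩
      1# + 1#            ≡⟨ char2 ⟩
      0#                 ∎)
    inU : ∀ {t} → t + conj t ≡ 1# → InU (1# + inv t)
    inU {t} eq = ⇒InU (begin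
      (1# + i) * conj (1# + i)          ≡⟨ cong ((1# + i) *_) (trans (conj-+ 1# i) (cong (_+ conj i) conj-1)) ⟩
      (1# + i) * (1# + conj i)          ≡⟨ solve 2 (λ i j → (con true :+ i) :* (con true :+ j) := con true :+ ((i :+ j) :+ i :* j)) refl i (conj i) ⟩
      1# + ((i + conj i) + i * conj i)  ≡⟨ cong (1# +_) (trans (cong₂ _+_ (T-inv eq) ij) (x+x≡0 _)) ⟩
      1# + 0#                           ≡⟨ +-identityʳ 1# ⟩
      1#                                ∎)
      where
      i = inv t
      ij : i * conj i ≡ inv (t * t + t)
      ij = trans (cong (i *_) (conj-inv t)) (trans (sym (inv-* t (conj t))) (cong inv (T-tt̄ eq)))
    inT : ∀ {w} → InU w → w ≢ 1# → inv (1# + w) + conj (inv (1# + w)) ≡ 1#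
    inT {w} pw w≢1 = *-cancelˡ (*-nonzero a≢0 (^-nonzero q a≢0)) (begin
      (a * conj a) * (inv a + conj (inv a))   ≡⟨ cong (λ z → (a * conj a) * (inv a + z)) (conj-inv a) ⟩
      (a * conj a) * (inv a + inv (conj a))
        ≡⟨ solve 4 (λ t s i j → (t :* s) :* (i :+ j) := s :* (t :* i) :+ t :* (s :* j)) refl a (conj a) (inv a) (inv (conj a)) ⟩
      conj a * (a * inv a) + a * (conj a * inv (conj a))
        ≡⟨ cong₂ (λ x y → conj a * x + a * y) (x*inv[x]≡1 a≢0) (x*inv[x]≡1 (^-nonzero q a≢0)) ⟩
      conj a * 1# + a * 1#                    ≡⟨ cong (λ z → z * 1# + a * 1#) ā ⟩
      (1# + conj w) * 1# + (1# + w) * 1#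
        ≡⟨ solve 2 (λ w v → (con true :+ v) :* con true :+ (con true :+ w) :* con true := ((con true :+ w) :* (con true :+ v) :+ con true) :+ w :* v) refl w (conj w) ⟩
      ((1# + w) * (1# + conj w) + 1#) + w * conj w
        ≡⟨ cong₂ (λ x y → (a * x + 1#) + y) (sym ā) (InU⇒ pw) ⟩
      (a * conj a + 1#) + 1#                  ≡⟨ solve 1 (λ z → (z :+ con true) :+ con true := z :* con true) refl (a * conj a) ⟩
      (a * conj a) * 1#                       ∎)
      where
      a = 1# + w
      a≢0 : a ≢ 0#
      a≢0 eq = w≢1 (sym (+-cancel eq))
      ā : conj a ≡ 1# + conj w
      ā = trans (conj-+ 1# w) (cong (_+ conj w) conj-1)

  ∑U : (g : Carrier → ℤ) → ∑ Us g ≡ g 1# ℤ.+ ∑ Ts (λ t → g (1# + inv t))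
  ∑U g = trans (∑.big-remove (_≟ 1#) Us-unique (∈Us U-1) refl (λ eq → eq) g)
    (cong (λ z → g 1# ℤ.+ z) (sym (∑.big-reindex Ts-unique U-≢1-unique Ts≅U-≢1 g)))

  Fqs≅Ts : Fqs ≅ Ts
  Fqs≅Ts = record
    { to = t₀ +_ ; from = t₀ +_
    ; to-∈ = λ y∈ → ∈Ts (inT (Fqs∋ y∈)) ; from-∈ = λ t∈ → ∈Fqs (inFq (Ts∋ t∈))
    ; from∘to = λ {y} _ → invol y ; to∘from = λ {y} _ → invol y }
    where
    invol : ∀ y → t₀ + (t₀ + y) ≡ y
    invol y = solve 2 (λ t y → t :+ (t :+ y) := y) refl t₀ y
    inT : ∀ {y} → InFq y → (t₀ + y) + conj (t₀ + y) ≡ 1#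
    inT {y} py = begin
      (t₀ + y) + conj (t₀ + y)     ≡⟨ cong ((t₀ + y) +_) (trans (conj-+ t₀ y) (cong (conj t₀ +_) py)) ⟩
      (t₀ + y) + (conj t₀ + y)     ≡⟨ solve 3 (λ t s y → (t :+ y) :+ (s :+ y) := t :+ s) refl t₀ (conj t₀) y ⟩
      t₀ + conj t₀                 ≡⟨ t₀+t̄₀ ⟩
      1#                           ∎
    inFq : ∀ {t} → t + conj t ≡ 1# → InFq (t₀ + t)
    inFq {t} eq = begin
      conj (t₀ + t)          ≡⟨ conj-+ t₀ t ⟩
      conj t₀ + conj t       ≡⟨ cong₂ _+_ t̄₀ (trans (x̄≡x+[x+x̄] t) (cong (t +_) eq)) ⟩
      (t₀ + 1#) + (t + 1#)   ≡⟨ solve 2 (λ t s → (t :+ con true) :+ (s :+ con true) := t :+ s) refl t₀ t ⟩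
      t₀ + t                 ∎

  module _ (g : Carrier → ℤ) where
    -- The factor 1 - ψ(s) counts the t in `Ts` with t² + t = s. Such a t forces Trn(s) = t + t̄ =
    -- 1, so here there is none.
    fibre-Tr≡0 : ∀ {s} → Trn s ≡ 0# → ∑ Ts (λ t → ∑.restrict (s ≟ (t * t + t)) (g s)) ≡ (1ℤ ℤ.- ψ s) ℤ.* g s
    fibre-Tr≡0 {s} Tr≡0 = begin
      ∑ Ts (λ t → ∑.restrict (s ≟ (t * t + t)) (g s))
        ≡⟨ ∑.big-cong Ts (λ {t} t∈ → ∑.restrict-no (s ≟ (t * t + t))
             (λ s≡ → 0≢1 (trans (sym Tr≡0) (trans (cong Trn s≡) (trans (Tr[x²+x] t) (Ts∋ t∈))))) (g s)) ⟩
      ∑ Ts (λ _ → 0ℤ)              ≡⟨ ∑.big-ε Ts ⟩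
      0ℤ                           ≡⟨ sym (ℤ.*-zeroˡ (g s)) ⟩
      (1ℤ ℤ.- 1ℤ) ℤ.* g s          ≡⟨ cong (λ z → (1ℤ ℤ.- z) ℤ.* g s) (sym (sign-0 Tr≡0)) ⟩
      (1ℤ ℤ.- ψ s) ℤ.* g s         ∎

    -- The solutions are t₁ and t₁ + 1. Both have relative trace Trn(s) = 1, hence belong to `Ts`,
    -- and the count is 2.
    fibre-Tr≡1 : ∀ {s t₁} → Trn s ≡ 1# → t₁ * t₁ + t₁ ≡ s →
                 ∑ Ts (λ t → ∑.restrict (s ≟ (t * t + t)) (g s)) ≡ (1ℤ ℤ.- ψ s) ℤ.* g s
    fibre-Tr≡1 {s} {t₁} Tr≡1 t₁²+t₁ = begin
      ∑ Ts (λ t → ∑.restrict (s ≟ (t * t + t)) (g s))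
        ≡⟨ ∑.big-cong Ts (λ {t} _ → two t (g s)) ⟩
      ∑ Ts (λ t → ∑.restrict (t ≟ t₁) (g s) ℤ.+ ∑.restrict (t ≟ (t₁ + 1#)) (g s))
        ≡⟨ ∑.big-∙ Ts (λ t → ∑.restrict (t ≟ t₁) (g s)) (λ t → ∑.restrict (t ≟ (t₁ + 1#)) (g s)) ⟩
      ∑ Ts (λ t → ∑.restrict (t ≟ t₁) (g s)) ℤ.+ ∑ Ts (λ t → ∑.restrict (t ≟ (t₁ + 1#)) (g s))
        ≡⟨ cong₂ ℤ._+_ (∑δ t₁∈T (g s)) (∑δ t₁+1∈T (g s)) ⟩
      g s ℤ.+ g s
        ≡⟨ ℤS.solve 1 (λ z → z ℤS.:+ z ℤS.:= (ℤS.con 1ℤ ℤS.:- ℤS.con -1ℤ) ℤS.:* z) refl (g s) ⟩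
      (1ℤ ℤ.- -1ℤ) ℤ.* g s         ≡⟨ cong (λ z → (1ℤ ℤ.- z) ℤ.* g s) (sym (sign-1 Tr≡1)) ⟩
      (1ℤ ℤ.- ψ s) ℤ.* g s         ∎
      where
      t₁∈T : t₁ + conj t₁ ≡ 1#
      t₁∈T = trans (sym (Tr[x²+x] t₁)) (trans (cong Trn t₁²+t₁) Tr≡1)
      t₁+1∈T : (t₁ + 1#) + conj (t₁ + 1#) ≡ 1#
      t₁+1∈T = trans (cong ((t₁ + 1#) +_) (trans (conj-+ t₁ 1#) (cong (conj t₁ +_) conj-1)))
        (trans (solve 2 (λ t s → (t :+ con true) :+ (s :+ con true) := t :+ s) refl t₁ (conj t₁)) t₁∈T)
      ∑δ : ∀ {a} → a + conj a ≡ 1# → ∀ m → ∑ Ts (λ t → ∑.restrict (t ≟ a) m) ≡ m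
      ∑δ {a} pa m = trans
        (∑.big-single Ts-unique (∈Ts pa) (λ t → ∑.restrict (t ≟ a) m) (λ {t} _ t≢a → ∑.restrict-no (t ≟ a) t≢a m))
        (∑.restrict-yes (a ≟ a) refl m)
      distinct : t₁ ≢ t₁ + 1#
      distinct eq = 0≢1 (begin
        0#             ≡⟨ sym (x+x≡0 t₁) ⟩
        t₁ + t₁        ≡⟨ cong (t₁ +_) eq ⟩
        t₁ + (t₁ + 1#) ≡⟨ solve 1 (λ t → t :+ (t :+ con true) := con true) refl t₁ ⟩
        1#             ∎)
      other : (t₁ + 1#) * (t₁ + 1#) + (t₁ + 1#) ≡ s
      other = trans (solve 1 (λ t → (t :+ con true) :* (t :+ con true) :+ (t :+ con true) := t :* t :+ t) refl t₁) t₁²+t₁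
      roots : ∀ {t} → t * t + t ≡ s → (t ≡ t₁) ⊎ (t ≡ t₁ + 1#)
      roots {t} eq = Sum.map +-cancel (λ t+t₁≡1 → trans (solve 2 (λ t r → t := r :+ (t :+ r)) refl t t₁) (cong (t₁ +_) t+t₁≡1))
        (x²≡x⇒x≡0∨1 (+-cancel (begin
          (t + t₁) * (t + t₁) + (t + t₁)  ≡⟨ solve 2 (λ t r → (t :+ r) :* (t :+ r) :+ (t :+ r) := (t :* t :+ t) :+ (r :* r :+ r)) refl t t₁ ⟩
          (t * t + t) + (t₁ * t₁ + t₁)    ≡⟨ cong₂ _+_ eq t₁²+t₁ ⟩
          s + s                           ≡⟨ x+x≡0 s ⟩
          0#                              ∎)))
      two : ∀ t m → ∑.restrict (s ≟ (t * t + t)) m ≡ ∑.restrict (t ≟ t₁) m ℤ.+ ∑.restrict (t ≟ (t₁ + 1#)) m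
      two t m = cases (t ≟ t₁) (t ≟ (t₁ + 1#))
        where
        cases : (d : Dec (t ≡ t₁)) (d′ : Dec (t ≡ t₁ + 1#)) →
                ∑.restrict (s ≟ (t * t + t)) m ≡ ∑.restrict d m ℤ.+ ∑.restrict d′ m
        cases (yes p) (yes r) = contradiction (trans (sym p) r) distinct
        cases (yes p) (no _)  = trans
          (∑.restrict-yes (s ≟ (t * t + t)) (sym (trans (cong (λ z → z * z + z) p) t₁²+t₁)) m) (sym (ℤ.+-identityʳ m))
        cases (no _)  (yes r) = trans
          (∑.restrict-yes (s ≟ (t * t + t)) (sym (trans (cong (λ z → z * z + z) r) other)) m) (sym (ℤ.+-identityˡ m))
        cases (no ¬p) (no ¬r) = ∑.restrict-no (s ≟ (t * t + t)) (λ eq → [ ¬p , ¬r ]′ (roots (sym eq))) m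

    fibre : ∀ {s} → InFq s → ∑ Ts (λ t → ∑.restrict (s ≟ (t * t + t)) (g s)) ≡ (1ℤ ℤ.- ψ s) ℤ.* g s
    fibre ps = [ fibre-Tr≡0 , (λ Tr≡1 → fibre-Tr≡1 Tr≡1 (proj₂ (artinSchreier ps))) ]′ (Tr∈𝔽₂ n ps)

    -- Insert a sum over s with the indicator of s = t² + t, exchange the sums, and count each
    -- fibre.
    ∑T-t²+t : ∑ Ts (λ t → g (t * t + t)) ≡ ∑ Fqs (λ s → (1ℤ ℤ.- ψ s) ℤ.* g s)
    ∑T-t²+t = begin
      ∑ Ts (λ t → g (t * t + t))
        ≡⟨ ∑.big-cong Ts (λ {t} t∈ → sym (single t (Ts∋ t∈))) ⟩
      ∑ Ts (λ t → ∑ Fqs (λ s → ∑.restrict (s ≟ (t * t + t)) (g s)))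
        ≡⟨ ∑.big-swap Ts Fqs _ ⟩
      ∑ Fqs (λ s → ∑ Ts (λ t → ∑.restrict (s ≟ (t * t + t)) (g s)))
        ≡⟨ ∑.big-cong Fqs (λ s∈ → fibre (Fqs∋ s∈)) ⟩
      ∑ Fqs (λ s → (1ℤ ℤ.- ψ s) ℤ.* g s) ∎
      where
      single : ∀ t → t + conj t ≡ 1# → ∑ Fqs (λ s → ∑.restrict (s ≟ (t * t + t)) (g s)) ≡ g (t * t + t)
      single t pt = trans
        (∑.big-single Fqs-unique (∈Fqs (Fq-t²+t pt)) _ (λ {s} _ s≢ → ∑.restrict-no (s ≟ (t * t + t)) s≢ (g s)))
        (∑.restrict-yes ((t * t + t) ≟ (t * t + t)) refl (g (t * t + t)))

  -- Kloosterman sums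

  invert : Fqs ≅ Fqs
  invert = record
    { to = inv ; from = inv
    ; to-∈ = λ y∈ → ∈Fqs (Fq-inv (Fqs∋ y∈)) ; from-∈ = λ y∈ → ∈Fqs (Fq-inv (Fqs∋ y∈))
    ; from∘to = λ {y} _ → inv-inv y ; to∘from = λ {y} _ → inv-inv y }

  module _ {c} (pc : InFq c) (c≢0 : c ≢ 0#) where
    ∑ψ[c/s] : ∑ Fqs (λ s → ψ (c * inv s)) ≡ 0ℤ
    ∑ψ[c/s] = trans (∑.big-reindex Fqs-unique Fqs-unique invert (λ s → ψ (c * s)))
      (trans (∑.big-cong Fqs (λ {s} _ → cong ψ (*-comm c s))) (∑ψ≡0 pc c≢0))

    ∑ψ[s]ψ[c/s] : ∑ Fqs (λ s → ψ s ℤ.* ψ (c * inv s)) ≡ Kloosterman c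
    ∑ψ[s]ψ[c/s] = begin
      ∑ Fqs (λ s → ψ s ℤ.* ψ (c * inv s))
        ≡⟨ ∑.big-cong Fqs (λ {s} s∈ → trans (sym (ψ-+ (Fqs∋ s∈) (Fq-* pc (Fq-inv (Fqs∋ s∈)))))
             (cong (λ z → ψ (z + c * inv s)) (sym (inv-inv s)))) ⟩
      ∑ Fqs (λ s → ψ (inv (inv s) + c * inv s))
        ≡⟨ ∑.big-reindex Fqs-unique Fqs-unique invert (λ s → ψ (inv s + c * s)) ⟩
      ∑ Fqs (λ s → ψ (inv s + c * s))
        ≡⟨ sym (sumℤ≡∑ Fqs _) ⟩
      Kloosterman c ∎

    ∑ψ[s] : ∑ Fqs ψ ≡ 0ℤ
    ∑ψ[s] = trans (∑.big-cong Fqs (λ {s} _ → cong ψ (sym (*-identityʳ s)))) (∑ψ≡0 conj-1 (0≢1 ∘ sym))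

    -- The point w = 1 contributes 1. In the weight 1 - ψ(s), the constant gives the sum of ψ(c/s),
    -- which vanishes, and -ψ(s) gives -K(c) after s is replaced by 1/s.
    ∑U-kloosterman : ∑ Us (λ w → ψ (c * (w + conj w))) ≡ 1ℤ ℤ.- Kloosterman c
    ∑U-kloosterman = begin
      ∑ Us (λ w → ψ (c * (w + conj w)))
        ≡⟨ ∑U (λ w → ψ (c * (w + conj w))) ⟩
      ψ (c * (1# + conj 1#)) ℤ.+ ∑ Ts (λ t → ψ (c * ((1# + inv t) + conj (1# + inv t))))
        ≡⟨ cong₂ ℤ._+_ (ψ-0 (trans (cong (c *_) (trans (cong (1# +_) conj-1) char2)) (zeroʳ c)))
             (∑.big-cong Ts (λ t∈ → cong (λ z → ψ (c * z)) (w+w̄ (Ts∋ t∈)))) ⟩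
      1ℤ ℤ.+ ∑ Ts (λ t → ψ (c * inv (t * t + t)))
        ≡⟨ cong (λ z → 1ℤ ℤ.+ z) (∑T-t²+t (λ s → ψ (c * inv s))) ⟩
      1ℤ ℤ.+ ∑ Fqs (λ s → (1ℤ ℤ.- ψ s) ℤ.* ψ (c * inv s))
        ≡⟨ cong (λ z → 1ℤ ℤ.+ z) (∑.big-cong Fqs (λ {s} _ → ℤS.solve 2 (λ a b → (ℤS.con 1ℤ ℤS.:- a) ℤS.:* b ℤS.:= b ℤS.:+ ℤS.con -1ℤ ℤS.:* (a ℤS.:* b)) refl (ψ s) (ψ (c * inv s)))) ⟩
      1ℤ ℤ.+ ∑ Fqs (λ s → ψ (c * inv s) ℤ.+ -1ℤ ℤ.* (ψ s ℤ.* ψ (c * inv s)))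
        ≡⟨ cong (λ z → 1ℤ ℤ.+ z) (trans (∑.big-∙ Fqs _ _) (cong₂ ℤ._+_ ∑ψ[c/s] (trans (∑-*ˡ Fqs -1ℤ _) (cong (-1ℤ ℤ.*_) ∑ψ[s]ψ[c/s])))) ⟩
      1ℤ ℤ.+ (0ℤ ℤ.+ -1ℤ ℤ.* Kloosterman c)
        ≡⟨ ℤS.solve 1 (λ k → ℤS.con 1ℤ ℤS.:+ (ℤS.con 0ℤ ℤS.:+ ℤS.con -1ℤ ℤS.:* k) ℤS.:= ℤS.con 1ℤ ℤS.:- k) refl (Kloosterman c) ⟩
      1ℤ ℤ.- Kloosterman c ∎
      where
      w+w̄ : ∀ {t} → t + conj t ≡ 1# → (1# + inv t) + conj (1# + inv t) ≡ inv (t * t + t)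
      w+w̄ {t} eq = begin
        (1# + inv t) + conj (1# + inv t)    ≡⟨ cong ((1# + inv t) +_) (trans (conj-+ 1# (inv t)) (cong (_+ conj (inv t)) conj-1)) ⟩
        (1# + inv t) + (1# + conj (inv t))  ≡⟨ solve 2 (λ i j → (con true :+ i) :+ (con true :+ j) := i :+ j) refl (inv t) (conj (inv t)) ⟩
        inv t + conj (inv t)                ≡⟨ T-inv eq ⟩
        inv (t * t + t)                     ∎

    -- Both factors of (1 − ψ(s))(1 − ψ(c/s)) are even, and its sum over s is q + K(c).
    4∣q+kloosterman : ∃ λ k → ℤ.+ q ℤ.+ Kloosterman c ≡ ℤ.+ 4 ℤ.* k
    4∣q+kloosterman = ∑ Fqs (λ s → half (Trn s) ℤ.* half (Trn (c * inv s))) , (begin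
      ℤ.+ q ℤ.+ Kloosterman c
        -- The two products with `0ℤ` hold the places of the vanishing sums of ψ(s) and ψ(c/s).
        ≡⟨ ℤS.solve 2 (λ a b → a ℤS.:+ b ℤS.:= (a ℤS.:+ ℤS.con -1ℤ ℤS.:* ℤS.con 0ℤ) ℤS.:+ (ℤS.con -1ℤ ℤS.:* ℤS.con 0ℤ ℤS.:+ b)) refl (ℤ.+ q) (Kloosterman c) ⟩
      (ℤ.+ q ℤ.+ -1ℤ ℤ.* 0ℤ) ℤ.+ (-1ℤ ℤ.* 0ℤ ℤ.+ Kloosterman c)
        ≡⟨ sym (cong₂ ℤ._+_
             (trans (∑.big-∙ Fqs _ _) (cong₂ ℤ._+_ (trans (∑-1 Fqs) (cong ℤ.+_ ∣Fq∣)) (trans (∑-*ˡ Fqs -1ℤ ψ) (cong (-1ℤ ℤ.*_) ∑ψ[s]))))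
             (trans (∑.big-∙ Fqs _ _) (cong₂ ℤ._+_ (trans (∑-*ˡ Fqs -1ℤ _) (cong (-1ℤ ℤ.*_) ∑ψ[c/s])) ∑ψ[s]ψ[c/s]))) ⟩
      ∑ Fqs (λ s → 1ℤ ℤ.+ -1ℤ ℤ.* ψ s) ℤ.+ ∑ Fqs (λ s → -1ℤ ℤ.* ψ (c * inv s) ℤ.+ ψ s ℤ.* ψ (c * inv s))
        ≡⟨ sym (∑.big-∙ Fqs _ _) ⟩
      ∑ Fqs (λ s → (1ℤ ℤ.+ -1ℤ ℤ.* ψ s) ℤ.+ (-1ℤ ℤ.* ψ (c * inv s) ℤ.+ ψ s ℤ.* ψ (c * inv s)))
        ≡⟨ ∑.big-cong Fqs (λ {s} _ → term (Trn s) (Trn (c * inv s))) ⟩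
      ∑ Fqs (λ s → ℤ.+ 4 ℤ.* (half (Trn s) ℤ.* half (Trn (c * inv s))))
        ≡⟨ ∑-*ˡ Fqs (ℤ.+ 4) _ ⟩
      ℤ.+ 4 ℤ.* ∑ Fqs (λ s → half (Trn s) ℤ.* half (Trn (c * inv s))) ∎)
      where
      half : Carrier → ℤ
      half t = ∑.restrict (¬? (t ≟ 0#)) 1ℤ
      term : ∀ s t → (1ℤ ℤ.+ -1ℤ ℤ.* sign s) ℤ.+ (-1ℤ ℤ.* sign t ℤ.+ sign s ℤ.* sign t) ≡ ℤ.+ 4 ℤ.* (half s ℤ.* half t)
      term s t with s ≟ 0# | t ≟ 0#
      ... | yes _ | yes _ = refl
      ... | yes _ | no _  = refl
      ... | no _  | yes _ = refl
      ... | no _  | no _  = refl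

-- Integers with equal squares, and what the Walsh value at 0 determines

∣i∣≡∣j∣⇒i≡±j : ∀ i j → ℤ.∣ i ∣ ≡ ℤ.∣ j ∣ → (i ≡ j) ⊎ (i ≡ ℤ.- j)
∣i∣≡∣j∣⇒i≡±j (ℤ.+ _)      (ℤ.+ _)      refl = inj₁ refl
∣i∣≡∣j∣⇒i≡±j (ℤ.+ _)      (ℤ.-[1+ _ ]) refl = inj₂ refl
∣i∣≡∣j∣⇒i≡±j (ℤ.-[1+ _ ]) (ℤ.+ _)      refl = inj₂ refl
∣i∣≡∣j∣⇒i≡±j (ℤ.-[1+ _ ]) (ℤ.-[1+ _ ]) refl = inj₁ refl

i*i≡j*j⇒i≡±j : ∀ {i j} → i ℤ.* i ≡ j ℤ.* j → (i ≡ j) ⊎ (i ≡ ℤ.- j)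
i*i≡j*j⇒i≡±j {i} {j} eq = ∣i∣≡∣j∣⇒i≡±j i j
  (m*m≡n*n⇒m≡n (trans (sym (ℤ.abs-* i i)) (trans (cong ℤ.∣_∣ eq) (ℤ.abs-* j j))))

n*k≢2 : ∀ {n} → 3 ℕ.≤ n → ∀ k → ℤ.∣ ℤ.+ n ℤ.* k ∣ ≢ 2
n*k≢2 {n} 3≤n k eq = ℕ.<⇒≱ 3≤n (ℕ.∣⇒≤ (ℕ.divides ℤ.∣ k ∣
  (trans (sym eq) (trans (ℤ.abs-* (ℤ.+ n) k) (ℕ.*-comm n ℤ.∣ k ∣)))))

module _ {p : ℕ} (3≤p : 3 ℕ.≤ p) where
  private
    P = ℤ.+ p
    instance _ = ℕ.>-nonZero (ℕ.≤-trans (s≤s z≤n) 3≤p)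

  -- Here p is q - 1 and W = ε + p S. If W = ε q then p S = p ε; if W = -ε q then p (S + ε) = -2 ε,
  -- impossible for p ≥ 3.
  walsh₀⇒S≡ε : ∀ {ε} S → (ε ≡ 1ℤ) ⊎ (ε ≡ -1ℤ) → let W = (ε ℤ.- S) ℤ.+ ℤ.+ suc p ℤ.* S in
               (W ≡ ℤ.+ suc p) ⊎ (W ≡ ℤ.- ℤ.+ suc p) → S ≡ ε
  walsh₀⇒S≡ε S (inj₁ refl) (inj₁ eq) = ℤ.*-cancelˡ-≡ P S 1ℤ (begin
    P ℤ.* S                                        ≡⟨ ℤS.solve 2 (λ P S → P ℤS.:* S ℤS.:= ((ℤS.con 1ℤ ℤS.:- S) ℤS.:+ (ℤS.con 1ℤ ℤS.:+ P) ℤS.:* S) ℤS.:- ℤS.con 1ℤ) refl P S ⟩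
    ((1ℤ ℤ.- S) ℤ.+ (1ℤ ℤ.+ P) ℤ.* S) ℤ.- 1ℤ       ≡⟨ cong (ℤ._- 1ℤ) eq ⟩
    (1ℤ ℤ.+ P) ℤ.- 1ℤ                              ≡⟨ ℤS.solve 1 (λ P → (ℤS.con 1ℤ ℤS.:+ P) ℤS.:- ℤS.con 1ℤ ℤS.:= P ℤS.:* ℤS.con 1ℤ) refl P ⟩
    P ℤ.* 1ℤ                                       ∎)
    where open ≡-Reasoning
  walsh₀⇒S≡ε S (inj₂ refl) (inj₂ eq) = ℤ.*-cancelˡ-≡ P S -1ℤ (begin
    P ℤ.* S                                        ≡⟨ ℤS.solve 2 (λ P S → P ℤS.:* S ℤS.:= ((ℤS.con -1ℤ ℤS.:- S) ℤS.:+ (ℤS.con 1ℤ ℤS.:+ P) ℤS.:* S) ℤS.:+ ℤS.con 1ℤ) refl P S ⟩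
    ((-1ℤ ℤ.- S) ℤ.+ (1ℤ ℤ.+ P) ℤ.* S) ℤ.+ 1ℤ      ≡⟨ cong (ℤ._+ 1ℤ) eq ⟩
    ℤ.- (1ℤ ℤ.+ P) ℤ.+ 1ℤ                          ≡⟨ ℤS.solve 1 (λ P → ℤS.:- (ℤS.con 1ℤ ℤS.:+ P) ℤS.:+ ℤS.con 1ℤ ℤS.:= P ℤS.:* ℤS.con -1ℤ) refl P ⟩
    P ℤ.* -1ℤ                                      ∎)
    where open ≡-Reasoning
  walsh₀⇒S≡ε S (inj₁ refl) (inj₂ eq) = contradiction (cong ℤ.∣_∣ (begin
    P ℤ.* (S ℤ.+ 1ℤ)                                     ≡⟨ ℤS.solve 2 (λ P S → P ℤS.:* (S ℤS.:+ ℤS.con 1ℤ) ℤS.:= ((ℤS.con 1ℤ ℤS.:- S) ℤS.:+ (ℤS.con 1ℤ ℤS.:+ P) ℤS.:* S) ℤS.:- ℤS.con 1ℤ ℤS.:+ P) refl P S ⟩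
    ((1ℤ ℤ.- S) ℤ.+ (1ℤ ℤ.+ P) ℤ.* S) ℤ.- 1ℤ ℤ.+ P       ≡⟨ cong (λ z → z ℤ.- 1ℤ ℤ.+ P) eq ⟩
    ℤ.- (1ℤ ℤ.+ P) ℤ.- 1ℤ ℤ.+ P                          ≡⟨ ℤS.solve 1 (λ P → ℤS.:- (ℤS.con 1ℤ ℤS.:+ P) ℤS.:- ℤS.con 1ℤ ℤS.:+ P ℤS.:= ℤS.con (ℤ.- ℤ.+ 2)) refl P ⟩
    ℤ.- ℤ.+ 2                                            ∎)) (n*k≢2 3≤p (S ℤ.+ 1ℤ))
    where open ≡-Reasoning
  walsh₀⇒S≡ε S (inj₂ refl) (inj₁ eq) = contradiction (cong ℤ.∣_∣ (begin
    P ℤ.* (S ℤ.- 1ℤ)                                     ≡⟨ ℤS.solve 2 (λ P S → P ℤS.:* (S ℤS.:- ℤS.con 1ℤ) ℤS.:= ((ℤS.con -1ℤ ℤS.:- S) ℤS.:+ (ℤS.con 1ℤ ℤS.:+ P) ℤS.:* S) ℤS.:+ ℤS.con 1ℤ ℤS.:- P) refl P S ⟩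
    ((-1ℤ ℤ.- S) ℤ.+ (1ℤ ℤ.+ P) ℤ.* S) ℤ.+ 1ℤ ℤ.- P      ≡⟨ cong (λ z → z ℤ.+ 1ℤ ℤ.- P) eq ⟩
    (1ℤ ℤ.+ P) ℤ.+ 1ℤ ℤ.- P                              ≡⟨ ℤS.solve 1 (λ P → (ℤS.con 1ℤ ℤS.:+ P) ℤS.:+ ℤS.con 1ℤ ℤS.:- P ℤS.:= ℤS.con (ℤ.+ 2)) refl P ⟩
    ℤ.+ 2                                                ∎)) (n*k≢2 3≤p (S ℤ.- 1ℤ))
    where open ≡-Reasoning

-- The Walsh transform of h₁ in terms of ε and S

module Bentness (n : ℕ) (n≥1 : n ℕ.≥ 1) (F : FiniteField2 (2 ℕ.* n)) (a1 b : FCarrier F)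
  (a1∈Fq : Setup.InFq n F a1) (a1≢0 : a1 ≢ FiniteField2.0# F) (b≢0 : b ≢ FiniteField2.0# F) where
  open Quadratic n n≥1 F public
  open ≡-Reasoning

  Q : ℤ
  Q = ℤ.+ q

  f : Carrier → ℤ
  f x = χ (a1 * inv (x ^ (q ℕ.∸ 1) + b))

  ε S : ℤ
  ε = χ (a1 * inv b)
  S = ∑ Us f

  q∸1 : suc (q ℕ.∸ 1) ≡ q
  q∸1 = ℕ.m+[n∸m]≡n (ℕ.≤-trans (s≤s z≤n) 2≤q)

  x*x^[q∸1] : ∀ x → x * x ^ (q ℕ.∸ 1) ≡ conj x
  x*x^[q∸1] x = cong (x ^_) q∸1

  f-0 : f 0# ≡ ε
  f-0 = cong (λ z → χ (a1 * inv z)) (trans (cong (_+ b) (0^ (ℕ.∸-monoˡ-≤ 1 2≤q))) (+-identityˡ b))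

  f-coset : ∀ {u y} → InU u → InFq y → y ≢ 0# → f (y * u) ≡ f u
  f-coset {u} {y} _ py y≢0 = cong (λ z → χ (a1 * inv (z + b))) (begin
    (y * u) ^ (q ℕ.∸ 1)              ≡⟨ ^-distrib-* y u (q ℕ.∸ 1) ⟩
    y ^ (q ℕ.∸ 1) * u ^ (q ℕ.∸ 1)    ≡⟨ cong (_* u ^ (q ℕ.∸ 1)) (*-cancelˡ y≢0 (trans (x*x^[q∸1] y) (trans py (sym (*-identityʳ y))))) ⟩
    1# * u ^ (q ℕ.∸ 1)               ≡⟨ *-identityˡ _ ⟩
    u ^ (q ℕ.∸ 1)                    ∎)

  f-± : ∀ x → (f x ≡ 1ℤ) ⊎ (f x ≡ -1ℤ)
  f-± x = sign-± (Tr2n (a1 * inv (x ^ (q ℕ.∸ 1) + b)))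

  ε-± : (ε ≡ 1ℤ) ⊎ (ε ≡ -1ℤ)
  ε-± = sign-± (Tr2n (a1 * inv b))

  walsh : ∀ ω → Walsh (h1 a1 b) ω ≡ (ε ℤ.- S) ℤ.+ Q ℤ.* ∑ Us (λ u → ∑.restrict (orthogonal ω u) (f u))
  walsh ω = begin
    Walsh (h1 a1 b) ω
      ≡⟨ sumℤ≡∑ elems (λ x → signB (h1 a1 b x xor bit (Tr2n (ω * x)))) ⟩
    ∑ elems (λ x → signB (h1 a1 b x xor bit (Tr2n (ω * x))))
      ≡⟨ ∑.big-cong elems (λ {x} _ → trans (signB-xor (h1 a1 b x) (bit (Tr2n (ω * x))))
           (cong₂ ℤ._*_ (signB-bit (Tr2n (a1 * inv (x ^ (q ℕ.∸ 1) + b)))) (signB-bit (Tr2n (ω * x))))) ⟩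
    ∑ elems (λ x → f x ℤ.* χ (ω * x))
      ≡⟨ walsh-coset f f-coset ω ⟩
    (f 0# ℤ.- S) ℤ.+ Q ℤ.* ∑ Us (λ u → ∑.restrict (orthogonal ω u) (f u))
      ≡⟨ cong (λ z → (z ℤ.- S) ℤ.+ Q ℤ.* ∑ Us (λ u → ∑.restrict (orthogonal ω u) (f u))) f-0 ⟩
    (ε ℤ.- S) ℤ.+ Q ℤ.* ∑ Us (λ u → ∑.restrict (orthogonal ω u) (f u)) ∎

  walsh-0 : Walsh (h1 a1 b) 0# ≡ (ε ℤ.- S) ℤ.+ Q ℤ.* S
  walsh-0 = trans (walsh 0#) (cong (λ z → (ε ℤ.- S) ℤ.+ Q ℤ.* z) (∑-orthogonal-0 f))

  walsh-≢0 : ∀ {ω} → ω ≢ 0# → ∃ λ v → Walsh (h1 a1 b) ω ≡ (ε ℤ.- S) ℤ.+ Q ℤ.* f v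
  walsh-≢0 {ω} ω≢0 = let v , eq = ∑-orthogonal ω≢0 in
    v , trans (walsh ω) (cong (λ z → (ε ℤ.- S) ℤ.+ Q ℤ.* z) (eq f))

  Q² : ℤ.+ (2 ℕ.^ (2 ℕ.* n)) ≡ Q ℤ.* Q
  Q² = trans (cong ℤ.+_ q²) (ℤ.pos-* q q)

  bent⇒± : Bent (h1 a1 b) → ∀ ω → (Walsh (h1 a1 b) ω ≡ Q) ⊎ (Walsh (h1 a1 b) ω ≡ ℤ.- Q)
  bent⇒± bent ω = i*i≡j*j⇒i≡±j (trans (bent ω) Q²)

  S≡ε⇒bent : S ≡ ε → Bent (h1 a1 b)
  S≡ε⇒bent S≡ε ω = by (ω ≟ 0#)
    where
    square : ∀ {e} w → (e ≡ 1ℤ) ⊎ (e ≡ -1ℤ) → w ≡ (ε ℤ.- S) ℤ.+ Q ℤ.* e → w ℤ.* w ≡ ℤ.+ (2 ℕ.^ (2 ℕ.* n))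
    square {e} w e± eq = begin
      w ℤ.* w                  ≡⟨ cong (λ z → z ℤ.* z) w≡ ⟩
      (Q ℤ.* e) ℤ.* (Q ℤ.* e)  ≡⟨ ℤS.solve 2 (λ Q e → (Q ℤS.:* e) ℤS.:* (Q ℤS.:* e) ℤS.:= (Q ℤS.:* Q) ℤS.:* (e ℤS.:* e)) refl Q e ⟩
      (Q ℤ.* Q) ℤ.* (e ℤ.* e)  ≡⟨ cong ((Q ℤ.* Q) ℤ.*_) (e² e±) ⟩
      (Q ℤ.* Q) ℤ.* 1ℤ         ≡⟨ ℤ.*-identityʳ (Q ℤ.* Q) ⟩
      Q ℤ.* Q                  ≡⟨ sym Q² ⟩
      ℤ.+ (2 ℕ.^ (2 ℕ.* n))    ∎
      where
      e² : (e ≡ 1ℤ) ⊎ (e ≡ -1ℤ) → e ℤ.* e ≡ 1ℤ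
      e² (inj₁ refl) = refl
      e² (inj₂ refl) = refl
      w≡ : w ≡ Q ℤ.* e
      w≡ = trans eq (trans (cong (λ z → (ε ℤ.- z) ℤ.+ Q ℤ.* e) S≡ε)
        (ℤS.solve 2 (λ a b → (a ℤS.:- a) ℤS.:+ b ℤS.:= b) refl ε (Q ℤ.* e)))
    by : Dec (ω ≡ 0#) → Walsh (h1 a1 b) ω ℤ.* Walsh (h1 a1 b) ω ≡ ℤ.+ (2 ℕ.^ (2 ℕ.* n))
    -- At ω = 0 the formula has S in the place of a sign f(v); since S = ε, it is itself a sign.
    by (yes ω≡0) = square (Walsh (h1 a1 b) ω) ε-±
      (trans (cong (Walsh (h1 a1 b)) ω≡0) (trans walsh-0 (cong (λ z → (ε ℤ.- S) ℤ.+ Q ℤ.* z) S≡ε)))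
    by (no ω≢0)  = let v , eq = walsh-≢0 ω≢0 in square (Walsh (h1 a1 b) ω) (f-± v) eq

  U-^[q∸1] : ∀ {u} → InU u → u ^ (q ℕ.∸ 1) ≡ conj u * conj u
  U-^[q∸1] {u} pu = *-cancelˡ (U-≢0 pu) (begin
    u * u ^ (q ℕ.∸ 1)      ≡⟨ x*x^[q∸1] u ⟩
    conj u                 ≡⟨ sym (*-identityˡ (conj u)) ⟩
    1# * conj u            ≡⟨ cong (_* conj u) (sym (InU⇒ pu)) ⟩
    (u * conj u) * conj u  ≡⟨ *-assoc u (conj u) (conj u) ⟩
    u * (conj u * conj u)  ∎)

  -- On the circle u^(q-1) = ū², a composite of conjugation and squaring, both of which are
  -- bijective.
  conj-square : Us ≅ Us
  conj-square = record
    { to = λ u → conj u * conj u ; from = λ v → conj (sqrt v)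
    ; to-∈ = λ u∈ → ∈Us (U-* (U-conj (Us∋ u∈)) (U-conj (Us∋ u∈)))
    ; from-∈ = λ v∈ → ∈Us (U-conj (U-^ (2 ℕ.^ (2 ℕ.* n ℕ.∸ 1)) (Us∋ v∈)))
    ; from∘to = λ {u} _ → trans (cong conj (sqrt-² (conj u))) (conj-conj u)
    ; to∘from = λ {v} _ → trans (cong (λ z → z * z) (conj-conj (sqrt v))) (sqrt-sqrt v) }

  S≡∑U : S ≡ ∑ Us (λ v → χ (a1 * inv (v + b)))
  S≡∑U = trans (∑.big-cong Us (λ u∈ → cong (λ z → χ (a1 * inv (z + b))) (U-^[q∸1] (Us∋ u∈))))
    (∑.big-reindex Us-unique Us-unique conj-square (λ v → χ (a1 * inv (v + b))))

  -- The case b ∈ U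

  module _ (b∈U : InU b) where
    rotate : Us ≅ Us
    rotate = record
      { to = b *_ ; from = conj b *_
      ; to-∈ = λ u∈ → ∈Us (U-* b∈U (Us∋ u∈)) ; from-∈ = λ u∈ → ∈Us (U-* (U-conj b∈U) (Us∋ u∈))
      ; from∘to = λ {u} _ → cancel (trans (*-comm (conj b) b) (InU⇒ b∈U)) u ; to∘from = λ {u} _ → cancel (InU⇒ b∈U) u }
      where
      cancel : ∀ {x y} → x * y ≡ 1# → ∀ z → x * (y * z) ≡ z
      cancel {x} {y} eq z = trans (sym (*-assoc x y z)) (trans (cong (_* z) eq) (*-identityˡ z))

    k : Carrier
    k = conj b * t₀ + conj (conj b * t₀)

    -- After v = b w and w = 1 + 1/t the denominator v + b is b/t, whose inverse b̄ t is linear in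
    -- t. With t = t₀ + y the exponent is affine in y of slope a₁ (b + b̄), and `k` gives its
    -- constant term. The pole v = b is w = 1 and contributes 1 because 1/0 = 0.
    S-b∈U : S ≡ 1ℤ ℤ.+ ψ (a1 * k) ℤ.* ∑.restrict ((a1 * (b + conj b)) ≟ 0#) Q
    S-b∈U = begin
      S
        ≡⟨ S≡∑U ⟩
      ∑ Us (λ v → χ (a1 * inv (v + b)))
        ≡⟨ sym (∑.big-reindex Us-unique Us-unique rotate (λ v → χ (a1 * inv (v + b)))) ⟩
      ∑ Us (λ w → χ (a1 * inv (b * w + b)))
        ≡⟨ ∑U (λ w → χ (a1 * inv (b * w + b))) ⟩
      χ (a1 * inv (b * 1# + b)) ℤ.+ ∑ Ts (λ t → χ (a1 * inv (b * (1# + inv t) + b)))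
        ≡⟨ cong₂ ℤ._+_ (χ-0 pole) (∑.big-cong Ts (λ {t} _ → cong (λ z → χ (a1 * z)) (inv≡ t))) ⟩
      1ℤ ℤ.+ ∑ Ts (λ t → χ (a1 * (conj b * t)))
        ≡⟨ cong (λ z → 1ℤ ℤ.+ z) (sym (∑.big-reindex Fqs-unique Ts-unique Fqs≅Ts (λ t → χ (a1 * (conj b * t))))) ⟩
      1ℤ ℤ.+ ∑ Fqs (λ y → χ (a1 * (conj b * (t₀ + y))))
        ≡⟨ cong (λ z → 1ℤ ℤ.+ z) (∑.big-cong Fqs (λ y∈ → affine (Fqs∋ y∈))) ⟩
      1ℤ ℤ.+ ∑ Fqs (λ y → ψ (a1 * k) ℤ.* ψ (y * (a1 * (b + conj b))))
        ≡⟨ cong (λ z → 1ℤ ℤ.+ z) (trans (∑-*ˡ Fqs (ψ (a1 * k)) (λ y → ψ (y * (a1 * (b + conj b)))))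
             (cong (ψ (a1 * k) ℤ.*_) (∑ψ (Fq-* a1∈Fq (Fq-x+x̄ b))))) ⟩
      1ℤ ℤ.+ ψ (a1 * k) ℤ.* ∑.restrict ((a1 * (b + conj b)) ≟ 0#) Q ∎
      where
      pole : a1 * inv (b * 1# + b) ≡ 0#
      pole = trans (cong (λ z → a1 * inv z) (solve 1 (λ b → b :* con true :+ b := con false) refl b))
        (trans (cong (a1 *_) inv-0) (zeroʳ a1))
      inv≡ : ∀ t → inv (b * (1# + inv t) + b) ≡ conj b * t
      inv≡ t = begin
        inv (b * (1# + inv t) + b)  ≡⟨ cong inv (solve 2 (λ b i → b :* (con true :+ i) :+ b := b :* i) refl b (inv t)) ⟩
        inv (b * inv t)             ≡⟨ inv-* b (inv t) ⟩
        inv b * inv (inv t)         ≡⟨ cong₂ _*_ (U-inv b∈U) (inv-inv t) ⟩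
        conj b * t                  ∎
      affine : ∀ {y} → InFq y → χ (a1 * (conj b * (t₀ + y))) ≡ ψ (a1 * k) ℤ.* ψ (y * (a1 * (b + conj b)))
      affine {y} py = begin
        χ (a1 * (conj b * (t₀ + y)))
          ≡⟨ χ-yx (conj b * (t₀ + y)) a1∈Fq ⟩
        ψ (a1 * (conj b * (t₀ + y) + conj (conj b * (t₀ + y))))
          ≡⟨ cong ψ (begin
            a1 * (conj b * (t₀ + y) + conj (conj b * (t₀ + y)))
              ≡⟨ cong (λ z → a1 * (conj b * (t₀ + y) + z)) (trans (conj-* (conj b) (t₀ + y)) (cong₂ _*_ (conj-conj b) (trans (conj-+ t₀ y) (cong (conj t₀ +_) py)))) ⟩
            a1 * (conj b * (t₀ + y) + b * (conj t₀ + y))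
              ≡⟨ solve 6 (λ a b c t s y → a :* (c :* (t :+ y) :+ b :* (s :+ y)) := a :* (c :* t :+ b :* s) :+ y :* (a :* (b :+ c))) refl a1 b (conj b) t₀ (conj t₀) y ⟩
            a1 * (conj b * t₀ + b * conj t₀) + y * (a1 * (b + conj b))
              ≡⟨ cong (λ z → a1 * (conj b * t₀ + z) + y * (a1 * (b + conj b))) (sym (trans (conj-* (conj b) t₀) (cong (_* conj t₀) (conj-conj b)))) ⟩
            a1 * k + y * (a1 * (b + conj b)) ∎) ⟩
        ψ (a1 * k + y * (a1 * (b + conj b)))
          ≡⟨ ψ-+ (Fq-* a1∈Fq (Fq-x+x̄ (conj b * t₀))) (Fq-* py (Fq-* a1∈Fq (Fq-x+x̄ b))) ⟩
        ψ (a1 * k) ℤ.* ψ (y * (a1 * (b + conj b))) ∎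

    -- A vanishing slope would put b in 𝔽_q, and 1 is the only point of U there.
    S-b∈U∖1 : b ≢ 1# → S ≡ 1ℤ
    S-b∈U∖1 b≢1 = trans S-b∈U (trans (cong (λ z → 1ℤ ℤ.+ ψ (a1 * k) ℤ.* z)
      (∑.restrict-no ((a1 * (b + conj b)) ≟ 0#) (λ eq → b≢1 (U∩Fq b∈U (sym (+-cancel (x*y≡0⇒y≡0 a1≢0 eq))))) Q))
      (cong (λ z → 1ℤ ℤ.+ z) (ℤ.*-zeroʳ (ψ (a1 * k)))))

    -- As S = 1, W(0) = ε - 1 + q. For ε = -1 this is q - 2, which is neither q nor -q; the argument
    -- includes q = 2, which `walsh₀⇒S≡ε` leaves out.
    bent⇒ε≡1 : b ≢ 1# → Bent (h1 a1 b) → ε ≡ 1ℤ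
    bent⇒ε≡1 b≢1 bent = by ε-± (Sum.map (trans (sym W₀)) (trans (sym W₀)) (bent⇒± bent 0#))
      where
      W₀ : Walsh (h1 a1 b) 0# ≡ (ε ℤ.- 1ℤ) ℤ.+ Q ℤ.* 1ℤ
      W₀ = trans walsh-0 (cong (λ z → (ε ℤ.- z) ℤ.+ Q ℤ.* z) (S-b∈U∖1 b≢1))
      neg : (-1ℤ ℤ.- 1ℤ) ℤ.+ Q ℤ.* 1ℤ ≡ ℤ.- Q → 2 ≡ q ℕ.+ q
      neg eq = ℤ.+-injective (begin
        ℤ.+ 2                                                   ≡⟨ ℤS.solve 1 (λ Q → ℤS.con (ℤ.+ 2) ℤS.:= Q ℤS.:- ((ℤS.con -1ℤ ℤS.:- ℤS.con 1ℤ) ℤS.:+ Q ℤS.:* ℤS.con 1ℤ)) refl Q ⟩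
        Q ℤ.- ((-1ℤ ℤ.- 1ℤ) ℤ.+ Q ℤ.* 1ℤ)                       ≡⟨ cong (λ z → Q ℤ.- z) eq ⟩
        Q ℤ.- (ℤ.- Q)                                           ≡⟨ cong (λ z → Q ℤ.+ z) (ℤ.neg-involutive Q) ⟩
        ℤ.+ (q ℕ.+ q)                                           ∎)
      pos : (-1ℤ ℤ.- 1ℤ) ℤ.+ Q ℤ.* 1ℤ ≡ Q → ℤ.+ 2 ≡ 0ℤ
      pos eq = begin
        ℤ.+ 2                                                   ≡⟨ ℤS.solve 1 (λ Q → ℤS.con (ℤ.+ 2) ℤS.:= Q ℤS.:- ((ℤS.con -1ℤ ℤS.:- ℤS.con 1ℤ) ℤS.:+ Q ℤS.:* ℤS.con 1ℤ)) refl Q ⟩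
        Q ℤ.- ((-1ℤ ℤ.- 1ℤ) ℤ.+ Q ℤ.* 1ℤ)                       ≡⟨ cong (λ z → Q ℤ.- z) eq ⟩
        Q ℤ.- Q                                                 ≡⟨ ℤ.+-inverseʳ Q ⟩
        0ℤ                                                      ∎
      by : (ε ≡ 1ℤ) ⊎ (ε ≡ -1ℤ) → ((ε ℤ.- 1ℤ) ℤ.+ Q ℤ.* 1ℤ ≡ Q) ⊎ ((ε ℤ.- 1ℤ) ℤ.+ Q ℤ.* 1ℤ ≡ ℤ.- Q) → ε ≡ 1ℤ
      by (inj₁ p) _ = p
      by (inj₂ p) (inj₁ r) = contradiction (pos (subst (λ e → (e ℤ.- 1ℤ) ℤ.+ Q ℤ.* 1ℤ ≡ Q) p r)) λ ()
      by (inj₂ p) (inj₂ r) = contradiction (neg (subst (λ e → (e ℤ.- 1ℤ) ℤ.+ Q ℤ.* 1ℤ ≡ ℤ.- Q) p r))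
        (ℕ.<⇒≢ (ℕ.≤-trans (s≤s (s≤s (s≤s z≤n))) (ℕ.+-mono-≤ 2≤q 2≤q)))

  -- For b = 1 every W(ω) with ω ≠ 0 is 0 or ±2q.
  ¬bent-b≡1 : b ≡ 1# → ¬ Bent (h1 a1 b)
  ¬bent-b≡1 b≡1 bent = [ (λ p → impossible (sign-± (Trn (a1 * k b∈U))) (f-± v) (inj₁ (cancel 1ℤ (trans (sym W≡) (trans p (sym (ℤ.*-identityʳ Q)))))))
                       , (λ p → impossible (sign-± (Trn (a1 * k b∈U))) (f-± v) (inj₂ (cancel -1ℤ (trans (sym W≡) (trans p (trans (sym (ℤ.-1*i≡-i Q)) (ℤ.*-comm -1ℤ Q))))))) ]′
                       (bent⇒± bent 1#)
    where
    instance _ = ℕ.>-nonZero (ℕ.≤-trans (s≤s z≤n) 2≤q)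
    b∈U : InU b
    b∈U = subst InU (sym b≡1) U-1
    b∈Fq : InFq b
    b∈Fq = subst InFq (sym b≡1) conj-1
    δ = ψ (a1 * k b∈U)
    v = proj₁ (walsh-≢0 (0≢1 ∘ sym))
    -- For b = 1 the slope a₁ (b + b̄) is 0, so the full sum over 𝔽_q survives.
    S≡ : S ≡ 1ℤ ℤ.+ δ ℤ.* Q
    S≡ = trans (S-b∈U b∈U) (cong (λ z → 1ℤ ℤ.+ δ ℤ.* z) (∑.restrict-yes ((a1 * (b + conj b)) ≟ 0#)
      (trans (cong (λ z → a1 * (b + z)) b∈Fq) (trans (cong (a1 *_) (x+x≡0 b)) (zeroʳ a1))) Q))
    ε≡1 : ε ≡ 1ℤ
    ε≡1 = trans (χ≡ψ (a1 * inv b)) (ψ-0 (trans (cong (a1 * inv b +_) (Fq-* a1∈Fq (Fq-inv b∈Fq))) (x+x≡0 _)))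
    W≡ : Walsh (h1 a1 b) 1# ≡ Q ℤ.* (f v ℤ.- δ)
    W≡ = begin
      Walsh (h1 a1 b) 1#                            ≡⟨ proj₂ (walsh-≢0 (0≢1 ∘ sym)) ⟩
      (ε ℤ.- S) ℤ.+ Q ℤ.* f v                       ≡⟨ cong₂ (λ x y → (x ℤ.- y) ℤ.+ Q ℤ.* f v) ε≡1 S≡ ⟩
      (1ℤ ℤ.- (1ℤ ℤ.+ δ ℤ.* Q)) ℤ.+ Q ℤ.* f v       ≡⟨ ℤS.solve 3 (λ d Q f → (ℤS.con 1ℤ ℤS.:- (ℤS.con 1ℤ ℤS.:+ d ℤS.:* Q)) ℤS.:+ Q ℤS.:* f ℤS.:= Q ℤS.:* (f ℤS.:- d)) refl δ Q (f v) ⟩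
      Q ℤ.* (f v ℤ.- δ)                             ∎
    cancel : ∀ z → Q ℤ.* (f v ℤ.- δ) ≡ Q ℤ.* z → f v ℤ.- δ ≡ z
    cancel z = ℤ.*-cancelˡ-≡ Q (f v ℤ.- δ) z
    -- A difference of two signs is 0 or ±2, never ±1.
    impossible : ∀ {d e} → (d ≡ 1ℤ) ⊎ (d ≡ -1ℤ) → (e ≡ 1ℤ) ⊎ (e ≡ -1ℤ) → (e ℤ.- d ≡ 1ℤ) ⊎ (e ℤ.- d ≡ -1ℤ) → ⊥
    impossible (inj₁ refl) (inj₁ refl) (inj₁ ())
    impossible (inj₁ refl) (inj₁ refl) (inj₂ ())
    impossible (inj₁ refl) (inj₂ refl) (inj₁ ())
    impossible (inj₁ refl) (inj₂ refl) (inj₂ ())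
    impossible (inj₂ refl) (inj₁ refl) (inj₁ ())
    impossible (inj₂ refl) (inj₁ refl) (inj₂ ())
    impossible (inj₂ refl) (inj₂ refl) (inj₁ ())
    impossible (inj₂ refl) (inj₂ refl) (inj₂ ())

  -- The case b ∉ U

  module _ (b∉U : ¬ InU b) where
    N M c : Carrier
    N = b * conj b
    M = 1# + N
    c = a1 * inv M

    M≢0 : M ≢ 0#
    M≢0 eq = b∉U (⇒InU (sym (+-cancel eq)))

    M∈Fq : InFq M
    M∈Fq = Fq-+ conj-1 (Fq-xx̄ b)

    c∈Fq : InFq c
    c∈Fq = Fq-* a1∈Fq (Fq-inv M∈Fq)

    c≢0 : c ≢ 0#
    c≢0 = *-nonzero a1≢0 (inv-≢0 M≢0)

    -- The map is v ↦ (1 + γ v)/(v + β). On the circle 1 + γ v = v (v̄ + γ), and v̄ + γ is the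
    -- conjugate of v + β, so numerator and denominator have equal norms. A general conjugate pair
    -- β, γ is used because the inverse map exchanges b and b̄.
    möbius-∈U : ∀ {β γ v} → conj β ≡ γ → conj γ ≡ β → InFq (1# + β * γ) → InU v → v + β ≢ 0# →
                InU ((1# + β * γ) * inv (v + β) + γ)
    möbius-∈U {β} {γ} {v} β̄ γ̄ m∈Fq pv z≢0 = ⇒InU (*-cancelˡ (*-nonzero z≢0 z̄≢0) (begin
      (z * z̄) * (w * conj w)                 ≡⟨ cong (λ x → (z * z̄) * (w * x)) w̄ ⟩
      (z * z̄) * ((m * i + γ) * (m * j + β))
        ≡⟨ solve 7 (λ z z̄ m i j g b → (z :* z̄) :* ((m :* i :+ g) :* (m :* j :+ b)) := (m :* (z :* i) :+ g :* z) :* (m :* (z̄ :* j) :+ b :* z̄)) refl z z̄ m i j γ β ⟩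
      (m * (z * i) + γ * z) * (m * (z̄ * j) + β * z̄)
        ≡⟨ cong₂ (λ x y → (m * x + γ * z) * (m * y + β * z̄)) (x*inv[x]≡1 z≢0) (x*inv[x]≡1 z̄≢0) ⟩
      (m * 1# + γ * z) * (m * 1# + β * z̄)
        ≡⟨ solve 4 (λ b g v u → ((con true :+ b :* g) :* con true :+ g :* (v :+ b)) :* ((con true :+ b :* g) :* con true :+ b :* (u :+ g))
                              := (v :+ b) :* (u :+ g) :* con true :+ (con true :+ b :* g) :* (con true :+ v :* u)) refl β γ v (conj v) ⟩
      (z * z̄) * 1# + m * (1# + v * conj v)   ≡⟨ cong (λ x → (z * z̄) * 1# + m * x) (trans (cong (1# +_) (InU⇒ pv)) char2) ⟩
      (z * z̄) * 1# + m * 0#                  ≡⟨ solve 2 (λ x m → x :* con true :+ m :* con false := x :* con true) refl (z * z̄) m ⟩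
      (z * z̄) * 1#                           ∎))
      where
      z = v + β
      z̄ = conj v + γ
      m = 1# + β * γ
      i = inv z
      j = inv z̄
      w = m * i + γ
      conj-z : conj z ≡ z̄
      conj-z = trans (conj-+ v β) (cong (conj v +_) β̄)
      z̄≢0 : z̄ ≢ 0#
      z̄≢0 = subst (_≢ 0#) conj-z (^-nonzero q z≢0)
      w̄ : conj w ≡ m * j + β
      w̄ = trans (conj-+ (m * i) γ) (cong₂ _+_ (trans (conj-* m i) (cong₂ _*_ m∈Fq (trans (conj-inv z) (cong inv conj-z)))) γ̄)

    -- Normalised so that c (w + b̄) = a₁/(v + b): in the variable w the exponent becomes linear. No
    -- denominator vanishes, since neither b nor b̄ is on the circle.
    möbius : Us ≅ Us
    möbius = record
      { to      = λ v → M * inv (v + b) + conj b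
      ; from    = λ w → M * inv (w + conj b) + b
      ; to-∈    = λ v∈ → ∈Us (möbius-∈U refl (conj-conj b) M∈Fq (Us∋ v∈) (v+b≢0 (Us∋ v∈)))
      ; from-∈  = λ {w} w∈ → ∈Us (subst (λ m → InU (m * inv (w + conj b) + b)) M-comm
                    (möbius-∈U (conj-conj b) refl (subst InFq (sym M-comm) M∈Fq) (Us∋ w∈) (w+b̄≢0 (Us∋ w∈))))
      ; from∘to = λ {v} v∈ → back (v+b≢0 (Us∋ v∈))
      ; to∘from = λ {w} w∈ → back (w+b̄≢0 (Us∋ w∈))
      }
      where
      M-comm : 1# + conj b * b ≡ M
      M-comm = cong (1# +_) (*-comm (conj b) b)
      v+b≢0 : ∀ {v} → InU v → v + b ≢ 0#
      v+b≢0 pv eq = b∉U (subst InU (+-cancel eq) pv)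
      w+b̄≢0 : ∀ {w} → InU w → w + conj b ≢ 0#
      w+b̄≢0 pw eq = b∉U (subst InU (trans (cong conj (+-cancel eq)) (conj-conj b)) (U-conj pw))
      back : ∀ {v β γ} → v + β ≢ 0# → M * inv ((M * inv (v + β) + γ) + γ) + β ≡ v
      back {v} {β} {γ} z≢0 = begin
        M * inv ((M * i + γ) + γ) + β  ≡⟨ cong (λ x → M * inv x + β) (solve 2 (λ x g → (x :+ g) :+ g := x) refl (M * i) γ) ⟩
        M * inv (M * i) + β            ≡⟨ cong (λ x → M * x + β) (trans (inv-* M i) (cong (inv M *_) (inv-inv (v + β)))) ⟩
        M * (inv M * (v + β)) + β      ≡⟨ cong (_+ β) (trans (cong (M *_) (*-comm (inv M) (v + β))) (x*[y*inv[x]]≡y (v + β) M≢0)) ⟩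
        (v + β) + β                    ≡⟨ solve 2 (λ v b → (v :+ b) :+ b := v) refl v β ⟩
        v                              ∎
        where i = inv (v + β)

    -- `δ` is the sign that splits off from every term of S, and `η` is the sign of the second trace
    -- in `Cond2`.
    δ η : ℤ
    δ = ψ (c * (b + conj b))
    η = ψ (a1 * (b + conj b) * inv ((1# + b * conj b) * (b * conj b)))

    -- The relative trace of c (w + b̄) is c (b + b̄) + c (w + w̄), so the sign `δ` is common to all
    -- terms.
    S-b∉U : S ≡ δ ℤ.* (1ℤ ℤ.- Kloosterman c)
    S-b∉U = begin
      S
        ≡⟨ S≡∑U ⟩
      ∑ Us (λ v → χ (a1 * inv (v + b)))
        ≡⟨ ∑.big-cong Us (λ {v} _ → cong χ (sym (image v))) ⟩
      ∑ Us (λ v → χ (c * ((M * inv (v + b) + conj b) + conj b)))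
        ≡⟨ ∑.big-reindex Us-unique Us-unique möbius (λ w → χ (c * (w + conj b))) ⟩
      ∑ Us (λ w → χ (c * (w + conj b)))
        ≡⟨ ∑.big-cong Us (λ {w} _ → split w) ⟩
      ∑ Us (λ w → δ ℤ.* ψ (c * (w + conj w)))
        ≡⟨ ∑-*ˡ Us δ (λ w → ψ (c * (w + conj w))) ⟩
      δ ℤ.* ∑ Us (λ w → ψ (c * (w + conj w)))
        ≡⟨ cong (δ ℤ.*_) (∑U-kloosterman c∈Fq c≢0) ⟩
      δ ℤ.* (1ℤ ℤ.- Kloosterman c) ∎
      where
      image : ∀ v → c * ((M * inv (v + b) + conj b) + conj b) ≡ a1 * inv (v + b)
      image v = begin
        (a1 * inv M) * ((M * i + conj b) + conj b)
          ≡⟨ solve 5 (λ a m M i g → (a :* m) :* ((M :* i :+ g) :+ g) := (M :* m) :* (a :* i)) refl a1 (inv M) M i (conj b) ⟩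
        (M * inv M) * (a1 * i)   ≡⟨ cong (_* (a1 * i)) (x*inv[x]≡1 M≢0) ⟩
        1# * (a1 * i)            ≡⟨ *-identityˡ (a1 * i) ⟩
        a1 * i                   ∎
        where i = inv (v + b)
      split : ∀ w → χ (c * (w + conj b)) ≡ δ ℤ.* ψ (c * (w + conj w))
      split w = begin
        χ (c * (w + conj b))
          ≡⟨ χ-yx (w + conj b) c∈Fq ⟩
        ψ (c * ((w + conj b) + conj (w + conj b)))
          ≡⟨ cong ψ (trans (cong (λ x → c * ((w + conj b) + x)) (trans (conj-+ w (conj b)) (cong (conj w +_) (conj-conj b))))
               (solve 5 (λ c w g u b → c :* ((w :+ g) :+ (u :+ b)) := c :* (b :+ g) :+ c :* (w :+ u)) refl c w (conj b) (conj w) b)) ⟩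
        ψ (c * (b + conj b) + c * (w + conj w))
          ≡⟨ ψ-+ (Fq-* c∈Fq (Fq-x+x̄ b)) (Fq-* c∈Fq (Fq-x+x̄ w)) ⟩
        δ ℤ.* ψ (c * (w + conj w)) ∎

    -- 1/N = 1/(1 + N) + 1/((1 + N) N)
    ε≡δη : ε ≡ δ ℤ.* η
    ε≡δη = begin
      ε                                          ≡⟨ χ-yx (inv b) a1∈Fq ⟩
      ψ (a1 * (inv b + conj (inv b)))            ≡⟨ cong ψ partialFractions ⟩
      ψ (c * (b + conj b) + a1 * (b + conj b) * inv (M * N))
        ≡⟨ ψ-+ (Fq-* c∈Fq (Fq-x+x̄ b)) (Fq-* (Fq-* a1∈Fq (Fq-x+x̄ b)) (Fq-inv (Fq-* M∈Fq (Fq-xx̄ b)))) ⟩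
      δ ℤ.* η                                    ∎
      where
      b̄ = conj b
      i = inv b
      j = inv b̄
      m = inv M
      bi≡1 : b * i ≡ 1#
      bi≡1 = x*inv[x]≡1 b≢0
      b̄j≡1 : b̄ * j ≡ 1#
      b̄j≡1 = x*inv[x]≡1 (^-nonzero q b≢0)
      partialFractions : a1 * (i + conj i) ≡ c * (b + b̄) + a1 * (b + b̄) * inv (M * N)
      partialFractions = begin
        a1 * (i + conj i)
          ≡⟨ cong (λ x → a1 * (i + x)) (conj-inv b) ⟩
        a1 * (i + j)
          -- The three ones are about to be written as b i, b̄ j and M m, which makes the partial
          -- fractions a polynomial identity free of division.
          ≡⟨ solve 3 (λ a i j → a :* (i :+ j) := a :* (con true :* j :+ con true :* i) :* con true) refl a1 i j ⟩
        a1 * (1# * j + 1# * i) * 1#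
          ≡⟨ sym (trans (cong₂ (λ x y → a1 * (x * j + y * i) * (M * m)) bi≡1 b̄j≡1) (cong (a1 * (1# * j + 1# * i) *_) (x*inv[x]≡1 M≢0))) ⟩
        a1 * ((b * i) * j + (b̄ * j) * i) * (M * m)
          ≡⟨ solve 6 (λ a b g i j m → a :* ((b :* i) :* j :+ (g :* j) :* i) :* ((con true :+ b :* g) :* m)
               := (a :* m) :* (b :+ g) :* ((b :* i) :* (g :* j)) :+ a :* (b :+ g) :* (m :* (i :* j))) refl a1 b b̄ i j m ⟩
        c * (b + b̄) * ((b * i) * (b̄ * j)) + a1 * (b + b̄) * (m * (i * j))
          ≡⟨ cong₂ (λ x y → c * (b + b̄) * x + a1 * (b + b̄) * y) (trans (cong₂ _*_ bi≡1 b̄j≡1) (*-identityˡ 1#))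
               (sym (trans (inv-* M N) (cong (m *_) (inv-* b b̄)))) ⟩
        c * (b + b̄) * 1# + a1 * (b + b̄) * inv (M * N)
          ≡⟨ cong (_+ a1 * (b + b̄) * inv (M * N)) (*-identityʳ (c * (b + b̄))) ⟩
        c * (b + b̄) + a1 * (b + b̄) * inv (M * N) ∎

    cond2⇒bent : Kloosterman c ≡ 0ℤ → η ≡ 1ℤ → Bent (h1 a1 b)
    cond2⇒bent K≡0 η≡1 = S≡ε⇒bent (begin
      S                                ≡⟨ S-b∉U ⟩
      δ ℤ.* (1ℤ ℤ.- Kloosterman c)     ≡⟨ cong (λ z → δ ℤ.* (1ℤ ℤ.- z)) K≡0 ⟩
      δ ℤ.* 1ℤ                         ≡⟨ cong (δ ℤ.*_) (sym η≡1) ⟩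
      δ ℤ.* η                          ≡⟨ sym ε≡δη ⟩
      ε                                ∎)

    bent⇒1-K≡η : 4 ℕ.≤ q → Bent (h1 a1 b) → 1ℤ ℤ.- Kloosterman c ≡ η
    bent⇒1-K≡η 4≤q bent = cancel-± (sign-± (Trn (c * (b + conj b)))) (trans (sym S-b∉U) (trans S≡ε ε≡δη))
      where
      Q≡ : Q ≡ ℤ.+ suc (q ℕ.∸ 1)
      Q≡ = cong ℤ.+_ (sym q∸1)
      S≡ε : S ≡ ε
      S≡ε = walsh₀⇒S≡ε (ℕ.∸-monoˡ-≤ 1 4≤q) S ε-± (subst (λ z → ((ε ℤ.- S) ℤ.+ z ℤ.* S ≡ z) ⊎ ((ε ℤ.- S) ℤ.+ z ℤ.* S ≡ ℤ.- z)) Q≡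
        (Sum.map (trans (sym walsh-0)) (trans (sym walsh-0)) (bent⇒± bent 0#)))
      cancel-± : ∀ {d x y} → (d ≡ 1ℤ) ⊎ (d ≡ -1ℤ) → d ℤ.* x ≡ d ℤ.* y → x ≡ y
      cancel-± {x = x} {y} (inj₁ refl) eq = ℤ.*-cancelˡ-≡ 1ℤ x y eq
      cancel-± {x = x} {y} (inj₂ refl) eq = ℤ.*-cancelˡ-≡ -1ℤ x y eq

    -- With η = -1 one would have K(c) = 1 - η = 2, yet 4 divides both q and q + K(c).
    bent⇒cond2 : 4 ℕ.∣ q → Bent (h1 a1 b) → Kloosterman c ≡ 0ℤ × η ≡ 1ℤ
    bent⇒cond2 4∣q@(ℕ.divides r q≡) bent = by (sign-± (Trn (a1 * (b + conj b) * inv ((1# + b * conj b) * (b * conj b)))))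
      where
      instance _ = ℕ.>-nonZero (ℕ.≤-trans (s≤s z≤n) 2≤q)
      1-K≡η : 1ℤ ℤ.- Kloosterman c ≡ η
      1-K≡η = bent⇒1-K≡η (ℕ.∣⇒≤ 4∣q) bent
      K≡1-η : Kloosterman c ≡ 1ℤ ℤ.- η
      K≡1-η = trans (ℤS.solve 1 (λ k → k ℤS.:= ℤS.con 1ℤ ℤS.:- (ℤS.con 1ℤ ℤS.:- k)) refl (Kloosterman c)) (cong (λ z → 1ℤ ℤ.- z) 1-K≡η)
      by : (η ≡ 1ℤ) ⊎ (η ≡ -1ℤ) → Kloosterman c ≡ 0ℤ × η ≡ 1ℤ
      by (inj₁ η≡1) = trans K≡1-η (cong (λ z → 1ℤ ℤ.- z) η≡1) , η≡1
      by (inj₂ η≡-1) = let l , eq = 4∣q+kloosterman c∈Fq c≢0 in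
        contradiction (cong ℤ.∣_∣ (begin
          ℤ.+ 4 ℤ.* (l ℤ.- ℤ.+ r)         ≡⟨ ℤS.solve 2 (λ l r → ℤS.con (ℤ.+ 4) ℤS.:* (l ℤS.:- r) ℤS.:= ℤS.con (ℤ.+ 4) ℤS.:* l ℤS.:- r ℤS.:* ℤS.con (ℤ.+ 4)) refl l (ℤ.+ r) ⟩
          ℤ.+ 4 ℤ.* l ℤ.- ℤ.+ r ℤ.* ℤ.+ 4 ≡⟨ cong₂ ℤ._-_ (sym eq) (trans (sym (ℤ.pos-* r 4)) (cong ℤ.+_ (sym q≡))) ⟩
          (Q ℤ.+ Kloosterman c) ℤ.- Q     ≡⟨ ℤS.solve 2 (λ Q k → (Q ℤS.:+ k) ℤS.:- Q ℤS.:= k) refl Q (Kloosterman c) ⟩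
          Kloosterman c                   ≡⟨ trans K≡1-η (cong (λ z → 1ℤ ℤ.- z) η≡-1) ⟩
          ℤ.+ 2                           ∎)) (n*k≢2 {4} (s≤s (s≤s (s≤s z≤n))) (l ℤ.- ℤ.+ r))

-- For n = 1 the unit circle is all of 𝔽₄*.
b∉U⇒4∣q : ∀ n → n ℕ.≥ 1 → (F : FiniteField2 (2 ℕ.* n)) (b : FCarrier F) →
           b ≢ FiniteField2.0# F → ¬ Setup.InU n F b → 4 ℕ.∣ 2 ℕ.^ n
b∉U⇒4∣q 1 _ F b b≢0 b∉U = contradiction (*-cancelˡ b≢0 (trans (fermat b) (sym (*-identityʳ b)))) b∉U
  where open Field F
b∉U⇒4∣q (suc (suc k)) _ F b b≢0 b∉U = ℕ.divides (2 ℕ.^ k) (trans (sym (ℕ.*-assoc 2 2 (2 ℕ.^ k))) (ℕ.*-comm 4 (2 ℕ.^ k)))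

open import Data.Nat using (_*_; _≥_)
open import Function.Bundles using (_⇔_)

theorem1 : (n : ℕ) → n ≥ 1 → (F : FiniteField2 (2 * n)) →
    (a1 b : FCarrier F) →
    Setup.InFq n F a1 → a1 ≢ FiniteField2.0# F → b ≢ FiniteField2.0# F →
    (Setup.Bent n F (Setup.h1 n F a1 b) ⇔ (Setup.Cond1 n F a1 b ⊎ Setup.Cond2 n F a1 b))
theorem1 n n≥1 F a1 b a1∈Fq a1≢0 b≢0 = mk⇔ (necessary ((b ^ (q ℕ.+ 1)) ≟ 1#)) sufficient
  where
  open Bentness n n≥1 F a1 b a1∈Fq a1≢0 b≢0
  necessary : Dec (InU b) → Bent (h1 a1 b) → Cond1 a1 b ⊎ Cond2 a1 b
  necessary (yes b∈U) bent = inj₁ (b∈U , b≢1 , sign≡1⇒≡0 (bent⇒ε≡1 b∈U b≢1 bent))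
    where
    b≢1 : b ≢ 1#
    b≢1 b≡1 = ¬bent-b≡1 b≡1 bent
  necessary (no b∉U) bent = let K≡0 , η≡1 = bent⇒cond2 b∉U (b∉U⇒4∣q n n≥1 F b b≢0 b∉U) bent in
    inj₂ (b∉U , K≡0 , sign≡1⇒≡0 η≡1)
  sufficient : Cond1 a1 b ⊎ Cond2 a1 b → Bent (h1 a1 b)
  sufficient (inj₁ (b∈U , b≢1 , Tr≡0)) = S≡ε⇒bent (trans (S-b∈U∖1 b∈U b≢1) (sym (sign-0 Tr≡0)))
  sufficient (inj₂ (b∉U , K≡0 , Tr≡0)) = cond2⇒bent b∉U K≡0 (sign-0 Tr≡0)
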